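{- Let $m$ be an odd positive integer and let $W=(w_{ -r},\ldots,w_r)\in\mathbb{Z}^{2r+1}$ be the weight sequence of a one-dimensional additive cellular automaton such that $\sigma=-2\sigma'$ and $\sigma$ is invertible modulo $m$. Let $a,d\in\mathbb{Z}/m\mathbb{Z}$ with $d$ invertible. Then, in the orbit $\mathcal{O}(\mathrm{AP}(a,d))$, every $(0,1)$-antisymmetric triangle of orientation $(-1,1)$ or $(1,-1)$ and of size $s$ is balanced, for all positive integers $s\equiv 0$ or $-1\pmod{\mathrm{lcm}(\mathrm{pord}_m(\sigma),m)}$.
   Context: The ACA with weights $W$ maps a sequence $(a_i)_{i\in\mathbb{Z}}$ of $\mathbb{Z}/m\mathbb{Z}$ to $\left(\sum_{j=-r}^{r}w_ja_{i+j}\right)_{i\in\mathbb{Z}}$; $\sigma=\sum_jw_j$, $\sigma'=\sum_j jw_j$. $\mathrm{AP}(a,d)=(a+id)_{i\in\mathbb{Z}}$. The orbit is the array $(a_{i,j})_{(i,j)\in\mathbb{Z}\times\mathbb{N}}$ whose $j$-th row is $\partial^j(\mathrm{AP}(a,d))$. The triangle with principal vertex $j\in\mathbb{Z}\times\mathbb{N}$, orientation $\varepsilon\in\{ -1,1\}^2$ and size $s$ is the multiset $\{a_{j+\varepsilon\cdot k}: k\in\mathbb{N}^2,\ k_1+k_2\le s-1\}$ ($\varepsilon\cdot k=(\varepsilon_1k_1,\varepsilon_2k_2)$, indices in $\mathbb{Z}\times\mathbb{N}$). It is $(0,1)$-antisymmetric if $a_{j+\varepsilon\cdot k}+a_{j+\varepsilon\cdot(s-1-k_1-k_2,\,k_2)}=0$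 for all $k\in\mathbb{N}^2$ with $k_1+k_2\le s-1$. Balanced means every element of $\mathbb{Z}/m\mathbb{Z}$ occurs with the same multiplicity. $\mathrm{pord}_m(\sigma)$ is the multiplicative order of $\sigma$ in $(\mathbb{Z}/m\mathbb{Z})^*/\{ -1,1\}$, i.e. the least $k\ge1$ with $\sigma^k\equiv\pm1\pmod m$. -}

module Defs where

open import Data.Nat as ℕ using (ℕ; zero; suc)
open import Data.Integer as ℤ using (ℤ; +_; _+_; _*_; _-_; -_)
open import Data.Integer.Divisibility as ℤd using ()
import Data.Nat.Divisibility as ℕd
open import Data.Fin using (Fin; toℕ)
open import Data.Vec using (Vec; lookup)
open import Data.List using (List; []; _∷_; map; concatMap; upTo; length; filter; foldr)
open import Data.List.Base using (allFin)
open import Data.Product using (_×_; _,_; proj₁; proj₂)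
open import Data.Sign using (Sign)
open import Relation.Unary using (Pred)

sumℤ : List ℤ → ℤ
sumℤ = foldr _+_ (+ 0)

-- Congruence modulo m in ℤ (equality in ℤ/mℤ, elements represented by integers).
infix 4 _≡_[mod_]
_≡_[mod_] : ℤ → ℤ → ℕ → Set
x ≡ y [mod m ] = (+ m) ℤd.∣ (x - y)

-- Weights W = (w_{-r},…,w_r): the entry at position p : Fin (2r+1) is w_{p-r}.
Weights : ℕ → Set
Weights r = Vec ℤ (suc (r ℕ.+ r))

idx : (r : ℕ) → Fin (suc (r ℕ.+ r)) → ℤ
idx r p = + toℕ p - + r

σ : (r : ℕ) → Weights r → ℤ
σ r w = sumℤ (map (λ p → lookup w p) (allFin _))

σ′ : (r : ℕ) → Weights r → ℤ
σ′ r w = sumℤ (map (λ p → idx r p * lookup w p) (allFin _))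

-- The ACA ∂ : (ℤ → ℤ) → (ℤ → ℤ),  (∂a)_i = Σ_{j=-r}^{r} w_j a_{i+j}
-- (computed on integer representatives; everything is compared modulo m)
∂ : (r : ℕ) → Weights r → (ℤ → ℤ) → (ℤ → ℤ)
∂ r w f i = sumℤ (map (λ p → lookup w p * f (i + idx r p)) (allFin _))

AP : ℤ → ℤ → ℤ → ℤ
AP a d i = a + i * d

orbit : (r : ℕ) → Weights r → ℤ → ℤ → ℕ → ℤ → ℤ
orbit r w a d zero    = AP a d
orbit r w a d (suc j) = ∂ r w (orbit r w a d j)

-- orbit extended by 0 to negative row indices (only used after checking
-- that the triangle lies in ℤ × ℕ, see `InOrbit`)
orbitℤ : (r : ℕ) → Weights r → ℤ → ℤ → ℤ → ℤ → ℤ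
orbitℤ r w a d i (+ j)      = orbit r w a d j i
orbitℤ r w a d i ℤ.-[1+ _ ] = + 0

Orientation : Set
Orientation = Sign × Sign

offsets : ℕ → List (ℕ × ℕ)
offsets s = concatMap (λ k₂ → map (λ k₁ → (k₁ , k₂)) (upTo (s ℕ.∸ k₂))) (upTo s)

-- the position j + ε·k for principal vertex (x , y)
pos : ℤ × ℕ → Orientation → ℕ × ℕ → ℤ × ℤ
pos (x , y) (ε₁ , ε₂) (k₁ , k₂) = (x + (ε₁ ℤ.◃ k₁) , (+ y) + (ε₂ ℤ.◃ k₂))

InOrbit : ℤ × ℕ → Orientation → ℕ → Set
InOrbit v ε s = ∀ k₁ k₂ → k₁ ℕ.+ k₂ ℕ.< s → + 0 ℤ.≤ proj₂ (pos v ε (k₁ , k₂))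

entry : (r : ℕ) → Weights r → ℤ → ℤ → ℤ × ℕ → Orientation → ℕ × ℕ → ℤ
entry r w a d v ε k with pos v ε k
... | (i , j) = orbitℤ r w a d i j

Antisymmetric01 : (m r : ℕ) → Weights r → ℤ → ℤ → ℤ × ℕ → Orientation → ℕ → Set
Antisymmetric01 m r w a d v ε s =
  ∀ k₁ k₂ → k₁ ℕ.+ k₂ ℕ.< s →
  entry r w a d v ε (k₁ , k₂) + entry r w a d v ε (s ℕ.∸ 1 ℕ.∸ k₁ ℕ.∸ k₂ , k₂) ≡ + 0 [mod m ]

multiplicity : (m r : ℕ) → Weights r → ℤ → ℤ → ℤ × ℕ → Orientation → ℕ → ℤ → ℕ
multiplicity m r w a d v ε s c =
  length (filter (λ k → m ℕd.∣? ℤ.∣ entry r w a d v ε k - c ∣) (offsets s))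

Balanced : (m r : ℕ) → Weights r → ℤ → ℤ → ℤ × ℕ → Orientation → ℕ → Set
Balanced m r w a d v ε s =
  ∀ c c′ → c ℕ.< m → c′ ℕ.< m →
  multiplicity m r w a d v ε s (+ c) ≡ multiplicity m r w a d v ε s (+ c′)
  where open import Relation.Binary.PropositionalEquality using (_≡_)

Invertible : ℕ → ℤ → Set
Invertible m x = Data.Product.∃ λ t → x * t ≡ + 1 [mod m ]
  where import Data.Product

PlusMinusOne : ℕ → ℤ → Set
PlusMinusOne m x = x ≡ + 1 [mod m ] Data.Sum.⊎ x ≡ - + 1 [mod m ]
  where import Data.Sum

IsPord : ℕ → ℤ → ℕ → Set
IsPord m x k = 1 ℕ.≤ k Data.Product.× PlusMinusOne m (x ℤ.^ k)
  Data.Product.× (∀ k′ → 1 ℕ.≤ k′ → k′ ℕ.< k → Relation.Nullary.¬ PlusMinusOne m (x ℤ.^ k′))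
  where import Data.Product
        import Relation.Nullary

{-# OPTIONS --safe #-}
-- Modulo m one has 2 a_{i,j} = σ^j (2a + (2i − j) d), and antisymmetry of the first
-- row turns the row of length n of the triangle into u ρ^n {n−1, n−3, …, 1−n} with a
-- unit u and ρ = σ^{±1}.  For f on ℤ/mℤ put S(f) = Σ_{n<s} Σ_{k<n} f(ρ^n (n−1−2k));
-- balance amounts to S(f(· + 1)) = S(f) for all f, when m and p divide s.
--
-- Since ρ^p = ±1 and each row is symmetric, S splits over the classes of n modulo p
-- into sums F(f) = Σ_t row(n₀ + tp, f).  Lengthening a row by p shifts it by p up to p
-- extra terms, which gives A + F(f) = F(f(· + p)) + G(f) with A the same for all
-- translates of f and G invariant under translation by p; iterating m times forces A = G,
-- so F and then S are invariant under translation by p.  Averaging f over the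
-- translates by multiples of p makes it periodic modulo g = gcd(p, m), and the claim
-- follows by induction on m: the powers of ρ are nonzero residues, so a suitable
-- divisor of p is less than m, whence g < m.
module Submission where

open import Defs
open import Data.Nat using (ℕ; _≤_; _<_; suc)
open import Data.Nat.Divisibility using (_∣_)
open import Data.Nat.LCM using (lcm)
open import Data.Integer using (ℤ; +_; -_; _*_)
open import Data.Sign using (Sign)
open import Data.Product using (_×_; _,_)
open import Data.Sum using (_⊎_)
open import Relation.Nullary using (¬_)
open import Relation.Binary.PropositionalEquality using (_≡_)

open import Algebra.Properties.CommutativeSemigroup using (interchange; x∙yz≈y∙xz)
open import Data.Bool using (if_then_else_; true; false)
open import Data.Fin using (Fin; toℕ; fromℕ<)
import Data.Fin.Properties as Finₚ
open import Data.Integer as ℤ using (-[1+_]; _+_; _-_; _^_)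
open import Data.Integer.DivMod using (_%ℕ_; _/ℕ_; n%ℕd<d; a≡a%ℕn+[a/ℕn]*n)
import Data.Integer.Divisibility.Signed as Signed
import Data.Integer.Properties as ℤₚ
open import Data.Integer.Tactic.RingSolver using (solve-∀)
open import Data.List using (List; []; _∷_; _++_; map; concatMap; applyUpTo; upTo; length; filter; allFin)
open import Data.List.Properties using (length-++; filter-++)
open import Data.Nat as ℕ using (zero; s≤s; z≤n; NonZero)
open import Data.Nat.Coprimality as Coprimality using (Coprime; coprime⇒GCD≡1; coprime-divisor)
open import Data.Nat.DivMod using (m<n⇒m%n≡m)
open import Data.Nat.Divisibility using (divides; ∣-trans; ∣⇒≤; 0∣⇒≡0; _∣?_)
open import Data.Nat.GCD using (module GCD; GCD; mkGCD; module Bézout)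
open import Data.Nat.Induction using (Acc; acc; <-wellFounded)
open import Data.Nat.LCM using (m∣lcm[m,n]; n∣lcm[m,n])
import Data.Nat.Properties as ℕₚ
open import Data.Product using (∃; proj₂)
open import Data.Sum as Sum using (inj₁; inj₂)
open import Data.Vec using (lookup)
open import Function using (_∘_; mk⇔)
open import Level using (0ℓ)
open import Relation.Binary.Bundles using (Setoid)
open import Relation.Binary.PropositionalEquality using (_≢_; refl; sym; trans; cong; cong₂; subst; module ≡-Reasoning)
open import Relation.Nullary using (Dec; yes; no; does; contradiction)
open import Relation.Nullary.Decidable using (does-⇔)
open import Relation.Unary using (Pred; Decidable)

-- Finite sums

∑ : ℕ → (ℕ → ℕ) → ℕ
∑ zero    f = 0
∑ (suc n) f = f 0 ℕ.+ ∑ n (f ∘ suc)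

∑-cong : ∀ n {f g} → (∀ i → i < n → f i ≡ g i) → ∑ n f ≡ ∑ n g
∑-cong zero    f≡g = refl
∑-cong (suc n) f≡g = cong₂ ℕ._+_ (f≡g 0 (s≤s z≤n)) (∑-cong n (λ i i<n → f≡g (suc i) (s≤s i<n)))

∑-cong′ : ∀ n {f g} → (∀ i → f i ≡ g i) → ∑ n f ≡ ∑ n g
∑-cong′ n f≡g = ∑-cong n (λ i _ → f≡g i)

∑-+ : ∀ n f g → ∑ n (λ i → f i ℕ.+ g i) ≡ ∑ n f ℕ.+ ∑ n g
∑-+ zero    f g = refl
∑-+ (suc n) f g = trans (cong (f 0 ℕ.+ g 0 ℕ.+_) (∑-+ n (f ∘ suc) (g ∘ suc)))
                        (interchange ℕₚ.+-commutativeSemigroup (f 0) (g 0) (∑ n (f ∘ suc)) (∑ n (g ∘ suc)))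

∑-const : ∀ n c → ∑ n (λ _ → c) ≡ n ℕ.* c
∑-const zero    c = refl
∑-const (suc n) c = cong (c ℕ.+_) (∑-const n c)

∑-comm : ∀ m n (f : ℕ → ℕ → ℕ) → ∑ m (λ i → ∑ n (f i)) ≡ ∑ n (λ j → ∑ m (λ i → f i j))
∑-comm zero    n f = sym (trans (∑-const n 0) (ℕₚ.*-zeroʳ n))
∑-comm (suc m) n f = trans (cong (∑ n (f 0) ℕ.+_) (∑-comm m n (f ∘ suc)))
                           (sym (∑-+ n (f 0) (λ j → ∑ m (λ i → f (suc i) j))))

∑-split : ∀ m n f → ∑ (m ℕ.+ n) f ≡ ∑ m f ℕ.+ ∑ n (λ i → f (m ℕ.+ i))
∑-split zero    n f = refl
∑-split (suc m) n f = trans (cong (f 0 ℕ.+_) (∑-split m n (f ∘ suc)))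
                            (sym (ℕₚ.+-assoc (f 0) (∑ m (f ∘ suc)) _))

∑-last : ∀ n f → ∑ (suc n) f ≡ ∑ n f ℕ.+ f n
∑-last zero    f = ℕₚ.+-comm (f 0) 0
∑-last (suc n) f = trans (cong (f 0 ℕ.+_) (∑-last n (f ∘ suc)))
                         (sym (ℕₚ.+-assoc (f 0) (∑ n (f ∘ suc)) (f (suc n))))

∑-cyclic : ∀ n f → f n ≡ f 0 → ∑ n (f ∘ suc) ≡ ∑ n f
∑-cyclic n f fn≡f0 = ℕₚ.+-cancelˡ-≡ (f 0) _ _ (begin
  f 0 ℕ.+ ∑ n (f ∘ suc) ≡⟨ ∑-last n f ⟩
  ∑ n f ℕ.+ f n         ≡⟨ cong (∑ n f ℕ.+_) fn≡f0 ⟩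
  ∑ n f ℕ.+ f 0         ≡⟨ ℕₚ.+-comm (∑ n f) (f 0) ⟩
  f 0 ℕ.+ ∑ n f         ∎)
  where open ≡-Reasoning

∑-reverse : ∀ n f → ∑ n (λ i → f (n ℕ.∸ suc i)) ≡ ∑ n f
∑-reverse zero    f = refl
∑-reverse (suc n) f = begin
  f n ℕ.+ ∑ n (λ i → f (n ℕ.∸ suc i)) ≡⟨ cong (f n ℕ.+_) (∑-reverse n f) ⟩
  f n ℕ.+ ∑ n f                       ≡⟨ ℕₚ.+-comm (f n) (∑ n f) ⟩
  ∑ n f ℕ.+ f n                       ≡⟨ ∑-last n f ⟨
  ∑ (suc n) f                         ∎
  where open ≡-Reasoning

∑-residues : ∀ T p f → ∑ (T ℕ.* p) f ≡ ∑ p (λ i → ∑ T (λ t → f (i ℕ.+ t ℕ.* p)))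
∑-residues zero    p f = sym (trans (∑-const p 0) (ℕₚ.*-zeroʳ p))
∑-residues (suc T) p f = begin
  ∑ (p ℕ.+ T ℕ.* p) f
    ≡⟨ ∑-split p (T ℕ.* p) f ⟩
  ∑ p f ℕ.+ ∑ (T ℕ.* p) (f ∘ (p ℕ.+_))
    ≡⟨ cong (∑ p f ℕ.+_) (∑-residues T p (f ∘ (p ℕ.+_))) ⟩
  ∑ p f ℕ.+ ∑ p (λ i → ∑ T (λ t → f (p ℕ.+ (i ℕ.+ t ℕ.* p))))
    ≡⟨ ∑-+ p f _ ⟨
  ∑ p (λ i → f i ℕ.+ ∑ T (λ t → f (p ℕ.+ (i ℕ.+ t ℕ.* p))))
    ≡⟨ ∑-cong′ p (λ i → cong₂ ℕ._+_ (cong f (sym (ℕₚ.+-identityʳ i)))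
                                    (∑-cong′ T (λ t → cong f (x∙yz≈y∙xz ℕₚ.+-commutativeSemigroup p i (t ℕ.* p))))) ⟩
  ∑ p (λ i → ∑ (suc T) (λ t → f (i ℕ.+ t ℕ.* p))) ∎
  where
  open ≡-Reasoning

-- Congruences and periodic functions

infix 4 _≈_[_]
-- The equation is solved for x, so that matching on `refl` eliminates x and reduces the basic rules
-- of congruence to ring identities.
record _≈_[_] (x y : ℤ) (m : ℕ) : Set where
  constructor multiple
  field
    quotient : ℤ
    equality : x ≡ y + quotient * + m

module _ {m : ℕ} where

  ≈-reflexive : ∀ {x y} → x ≡ y → x ≈ y [ m ]
  ≈-reflexive {x} refl = multiple (+ 0) (sym (ℤₚ.+-identityʳ x))

  ≈-refl : ∀ {x} → x ≈ x [ m ]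
  ≈-refl = ≈-reflexive refl

  ≈-sym : ∀ {x y} → x ≈ y [ m ] → y ≈ x [ m ]
  ≈-sym {y = y} (multiple q refl) = multiple (- q) (lemma y q (+ m))
    where
    lemma : ∀ y q m → y ≡ y + q * m + - q * m
    lemma = solve-∀

  ≈-trans : ∀ {x y z} → x ≈ y [ m ] → y ≈ z [ m ] → x ≈ z [ m ]
  ≈-trans {z = z} (multiple q refl) (multiple q′ refl) = multiple (q′ + q) (lemma z q q′ (+ m))
    where
    lemma : ∀ z q q′ m → z + q′ * m + q * m ≡ z + (q′ + q) * m
    lemma = solve-∀

  +-≈ : ∀ {x x′ y y′} → x ≈ x′ [ m ] → y ≈ y′ [ m ] → x + y ≈ x′ + y′ [ m ]
  +-≈ {x′ = x} {y′ = y} (multiple q refl) (multiple q′ refl) = multiple (q + q′) (lemma x y q q′ (+ m))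
    where
    lemma : ∀ x y q q′ m → x + q * m + (y + q′ * m) ≡ x + y + (q + q′) * m
    lemma = solve-∀

  *-≈ : ∀ {x x′ y y′} → x ≈ x′ [ m ] → y ≈ y′ [ m ] → x * y ≈ x′ * y′ [ m ]
  *-≈ {x′ = x} {y′ = y} (multiple q refl) (multiple q′ refl) =
    multiple (q * y + x * q′ + q * q′ * + m) (lemma x y q q′ (+ m))
    where
    lemma : ∀ x y q q′ m → (x + q * m) * (y + q′ * m) ≡ x * y + (q * y + x * q′ + q * q′ * m) * m
    lemma = solve-∀

  *ˡ-≈ : ∀ z {x y} → x ≈ y [ m ] → z * x ≈ z * y [ m ]
  *ˡ-≈ z = *-≈ (≈-refl {z})

  *ʳ-≈ : ∀ z {x y} → x ≈ y [ m ] → x * z ≈ y * z [ m ]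
  *ʳ-≈ z x≈y = *-≈ x≈y (≈-refl {z})

  +ˡ-≈ : ∀ z {x y} → x ≈ y [ m ] → z + x ≈ z + y [ m ]
  +ˡ-≈ z = +-≈ (≈-refl {z})

  +ʳ-≈ : ∀ z {x y} → x ≈ y [ m ] → x + z ≈ y + z [ m ]
  +ʳ-≈ z x≈y = +-≈ x≈y (≈-refl {z})

  -‿≈ : ∀ {x y} → x ≈ y [ m ] → - x ≈ - y [ m ]
  -‿≈ {y = y} (multiple q refl) = multiple (- q) (lemma y q (+ m))
    where
    lemma : ∀ y q m → - (y + q * m) ≡ - y + - q * m
    lemma = solve-∀

  ^-≈ : ∀ n {x y} → x ≈ y [ m ] → x ^ n ≈ y ^ n [ m ]
  ^-≈ zero    x≈y = ≈-refl
  ^-≈ (suc n) x≈y = *-≈ x≈y (^-≈ n x≈y)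

  mod⇒≈ : ∀ {x y} → x ≡ y [mod m ] → x ≈ y [ m ]
  mod⇒≈ {x} {y} m∣x-y with Signed.∣ᵤ⇒∣ {+ m} {x - y} m∣x-y
  ... | Signed.divides q eq = multiple q (trans (lemma x y) (cong (λ z → y + z) eq))
    where
    lemma : ∀ x y → x ≡ y + (x - y)
    lemma = solve-∀

  +-modulus : ∀ x → x + + m ≈ x [ m ]
  +-modulus x = multiple (+ 1) (cong (λ z → x + z) (sym (ℤₚ.*-identityˡ (+ m))))

  +-modulus-* : ∀ x y → x + + m * y ≈ x [ m ]
  +-modulus-* x y = multiple y (cong (λ z → x + z) (ℤₚ.*-comm (+ m) y))

≈-setoid : ℕ → Setoid 0ℓ 0ℓ
≈-setoid m = record
  { Carrier = ℤ ; _≈_ = λ x y → x ≈ y [ m ]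
  ; isEquivalence = record { refl = ≈-refl ; sym = ≈-sym ; trans = ≈-trans } }

module ≈-Reasoning (m : ℕ) where
  open import Relation.Binary.Reasoning.Setoid (≈-setoid m) public

≈-∣ : ∀ {g m x y} → g ∣ m → x ≈ y [ m ] → x ≈ y [ g ]
≈-∣ {g} {y = y} (divides k refl) (multiple q refl) =
  multiple (q * + k) (cong (λ z → y + z) (trans (cong (q *_) (ℤₚ.pos-* k g)) (sym (ℤₚ.*-assoc q (+ k) (+ g)))))

-- Translation invariance and periodicity of functions on ℤ.

Invariant : ℤ → (ℤ → ℕ) → Set
Invariant p f = ∀ x → f (x + p) ≡ f x

invariant-* : ∀ {p f} → Invariant p f → ∀ i → Invariant (i * p) f
invariant-* {p} {f} inv (+ n) = nat n
  where
  nat : ∀ n → Invariant (+ n * p) f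
  nat zero    x = cong f (ℤₚ.+-identityʳ x)
  nat (suc n) x = trans (cong f (lemma x p (+ n))) (trans (inv (x + + n * p)) (nat n x))
    where
    lemma : ∀ x p n → x + (+ 1 + n) * p ≡ x + n * p + p
    lemma = solve-∀
invariant-* {p} {f} inv -[1+ n ] x =
  sym (trans (cong f (lemma x p (+ suc n))) (invariant-* inv (+ suc n) (x + -[1+ n ] * p)))
  where
  lemma : ∀ x p n → x ≡ x + - n * p + n * p
  lemma = solve-∀

-- Over ℕ the Bézout identity has no subtraction, so j m is first added at no cost; the total shift
-- is then a multiple of p.
invariant-bezout : ∀ {p m g f} → Invariant (+ p) f → Invariant (+ m) f →
  ∀ i j → g ℕ.+ j ℕ.* m ≡ i ℕ.* p → Invariant (+ g) f
invariant-bezout {p} {m} {g} {f} invₚ invₘ i j eq x = begin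
  f (x + + g)               ≡⟨ invariant-* invₘ (+ j) (x + + g) ⟨
  f (x + + g + + j * + m)   ≡⟨ cong f (ℤₚ.+-assoc x (+ g) _) ⟩
  f (x + (+ g + + j * + m)) ≡⟨ cong (λ z → f (x + z)) eqℤ ⟩
  f (x + + i * + p)         ≡⟨ invariant-* invₚ (+ i) x ⟩
  f x                       ∎
  where
  open ≡-Reasoning
  eqℤ : + g + + j * + m ≡ + i * + p
  eqℤ = trans (cong (λ z → + g + z) (sym (ℤₚ.pos-* j m))) (trans (cong +_ eq) (ℤₚ.pos-* i p))

invariant-GCD : ∀ {p m g f} → GCD p m g → Invariant (+ p) f → Invariant (+ m) f → Invariant (+ g) f
invariant-GCD isGCD invₚ invₘ with Bézout.identity isGCD
... | Bézout.+- i j eq = invariant-bezout invₚ invₘ i j eq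
... | Bézout.-+ i j eq = invariant-bezout invₘ invₚ j i eq

Periodic : ℕ → (ℤ → ℕ) → Set
Periodic m f = ∀ {x y} → x ≈ y [ m ] → f x ≡ f y

invariant⇒periodic : ∀ {m f} → Invariant (+ m) f → Periodic m f
invariant⇒periodic inv {y = y} (multiple q refl) = invariant-* inv q y

-- Rows and classes of rows

∣⇒+≈0 : ∀ {m n} → m ∣ n → + n ≈ + 0 [ m ]
∣⇒+≈0 {m} (divides q refl) = multiple (+ q) (trans (ℤₚ.pos-* q m) (sym (ℤₚ.+-identityˡ _)))

∣⇒≈0 : ∀ {m x} → m ∣ ℤ.∣ x ∣ → x ≈ + 0 [ m ]
∣⇒≈0 {m} {x} m∣x with Signed.∣ᵤ⇒∣ {+ m} {x} m∣x
... | Signed.divides q eq = multiple q (trans eq (sym (ℤₚ.+-identityˡ _)))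

≈0⇒∣ : ∀ {m x} → x ≈ + 0 [ m ] → m ∣ ℤ.∣ x ∣
≈0⇒∣ {m} {x} (multiple q eq) = Signed.∣⇒∣ᵤ {+ m} {x} (Signed.divides q (trans eq (ℤₚ.+-identityˡ _)))

translate : (ℤ → ℕ) → ℤ → ℤ → ℕ
translate f c x = f (x + c)

periodic-translate : ∀ {m f} c → Periodic m f → Periodic m (translate f c)
periodic-translate c per x≈y = per (+ʳ-≈ c x≈y)

periodic-* : ∀ {m f} e → Periodic m f → Periodic m (λ x → f (e * x))
periodic-* e per x≈y = per (*ˡ-≈ e x≈y)

-- For k < n these are the terms n - 1, n - 3, ..., 1 - n of a progression symmetric about 0.
centred : ℕ → ℕ → ℤ
centred n k = + n - (+ 1 + + 2 * + k)

row : ℕ → (ℤ → ℕ) → ℕ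
row n f = ∑ n (λ k → f (centred n k))

row-cong : ∀ n {f g} → (∀ x → f x ≡ g x) → row n f ≡ row n g
row-cong n f≡g = ∑-cong′ n (λ k → f≡g (centred n k))

-- Negation reverses the progression: the terms of indices i and n - 1 - i are opposite.
row-neg : ∀ n f → row n (f ∘ -_) ≡ row n f
row-neg n f = trans (∑-cong n (λ i i<n → cong f (sym (mirror i<n)))) (∑-reverse n (f ∘ centred n))
  where
  lemma : ∀ i j → j + (+ 1 + i) - (+ 1 + + 2 * j) ≡ - (j + (+ 1 + i) - (+ 1 + + 2 * i))
  lemma = solve-∀
  mirror : ∀ {i} → i < n → centred n (n ℕ.∸ suc i) ≡ - centred n i
  mirror {i} i<n = subst (λ N → + N - (+ 1 + + 2 * + (n ℕ.∸ suc i)) ≡ - (+ N - (+ 1 + + 2 * + i)))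
                         (ℕₚ.m∸n+n≡m i<n) (lemma (+ i) (+ (n ℕ.∸ suc i)))

-- A progression of step -2. When m is odd and divides s, it runs s / m times through all residues,
-- so the sum of an m-periodic f forgets the starting point b.
descend : ℕ → (ℤ → ℕ) → ℤ → ℕ
descend s f b = ∑ s (λ k → f (b - + 2 * + k))

module _ {m s : ℕ} {f : ℤ → ℕ} (m-odd : Coprime 2 m) (m∣s : m ∣ s) (per : Periodic m f) where

  -- Moving b to b + 2 rotates the terms, because 2 s ≡ 0 modulo m; moving b by m changes nothing;
  -- and 2 is coprime to m.
  descend-invariant : Invariant (+ 1) (descend s f)
  descend-invariant = invariant-GCD (coprime⇒GCD≡1 m-odd) by-2 (λ b → ∑-cong′ s (λ k → per (+ʳ-≈ (- (+ 2 * + k)) (+-modulus b))))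
    where
    lemma : ∀ b k → b + + 2 - + 2 * (+ 1 + k) ≡ b - + 2 * k
    lemma = solve-∀
    by-2 : Invariant (+ 2) (descend s f)
    by-2 b = trans (sym (∑-cyclic s (λ k → f (b + + 2 - + 2 * + k))
                     (per (+ˡ-≈ (b + + 2) (-‿≈ (*ˡ-≈ (+ 2) (∣⇒+≈0 m∣s)))))))
                   (∑-cong′ s (λ k → cong f (lemma b (+ k))))

  descend-const : ∀ b → descend s f b ≡ descend s f (+ 0)
  descend-const b = trans (cong (descend s f) (lemma b)) (invariant-* descend-invariant b (+ 0))
    where
    lemma : ∀ b → b ≡ + 0 + b * + 1
    lemma = solve-∀

  -- The first s terms form a full progression of step -2, and the last n terms are the row of
  -- length n translated by -s ≡ 0.
  row-extend : ∀ n → row (n ℕ.+ s) f ≡ descend s f (+ 0) ℕ.+ row n f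
  row-extend n = begin
    row (n ℕ.+ s) f
      ≡⟨ cong (λ N → ∑ N (f ∘ centred (n ℕ.+ s))) (ℕₚ.+-comm n s) ⟩
    ∑ (s ℕ.+ n) (f ∘ centred (n ℕ.+ s))
      ≡⟨ ∑-split s n _ ⟩
    ∑ s (f ∘ centred (n ℕ.+ s)) ℕ.+ ∑ n (λ k → f (centred (n ℕ.+ s) (s ℕ.+ k)))
      ≡⟨ cong₂ ℕ._+_ (∑-cong′ s (λ k → cong f (lemma₁ (+ n + + s) (+ k))))
                     (∑-cong′ n (λ k → per (rest k))) ⟩
    descend s f (+ n + + s - + 1) ℕ.+ row n f
      ≡⟨ cong (ℕ._+ row n f) (descend-const (+ n + + s - + 1)) ⟩
    descend s f (+ 0) ℕ.+ row n f ∎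
    where
    open ≡-Reasoning
    lemma₁ : ∀ n k → n - (+ 1 + + 2 * k) ≡ n - + 1 - + 2 * k
    lemma₁ = solve-∀
    lemma₂ : ∀ n s k → n + s - (+ 1 + + 2 * (s + k)) ≡ n - (+ 1 + + 2 * k) + - s
    lemma₂ = solve-∀
    rest : ∀ k → centred (n ℕ.+ s) (s ℕ.+ k) ≈ centred n k [ m ]
    rest k = ≈-trans (≈-reflexive (lemma₂ (+ n) (+ s) (+ k)))
               (≈-trans (+ˡ-≈ (centred n k) (-‿≈ (∣⇒+≈0 m∣s))) (≈-reflexive (ℤₚ.+-identityʳ _)))

-- The longer row starts p higher: its first n terms are the old ones plus p, and its p lowest terms
-- are left over.
row-shift : ∀ n p f →
  row (n ℕ.+ p) f ≡ row n (translate f (+ p)) ℕ.+ ∑ p (λ k → f (+ p - (+ 1 + + 2 * + k) - + n))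
row-shift n p f = trans (∑-split n p (f ∘ centred (n ℕ.+ p)))
  (cong₂ ℕ._+_ (∑-cong′ n (λ k → cong f (lemma₁ (+ n) (+ p) (+ k))))
               (∑-cong′ p (λ k → cong f (lemma₂ (+ n) (+ p) (+ k)))))
  where
  lemma₁ : ∀ n p k → n + p - (+ 1 + + 2 * k) ≡ n - (+ 1 + + 2 * k) + p
  lemma₁ = solve-∀
  lemma₂ : ∀ n p k → n + p - (+ 1 + + 2 * (n + k)) ≡ p - (+ 1 + + 2 * k) - n
  lemma₂ = solve-∀

-- Over the m steps from c to c + m p the values of `Φ` cancel and `Γ` stays constant, so m A = m
-- Γ(c); then A = Γ(c), and a single step preserves `Φ`. The relations are additive because the
-- values lie in ℕ.
telescope : ∀ {p Φ Γ A} m .{{_ : NonZero m}} → Invariant p Γ → Invariant (+ m * p) Φ →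
  (∀ c → A ℕ.+ Φ c ≡ Φ (c + p) ℕ.+ Γ c) → Invariant p Φ
telescope {p} {Φ} {Γ} {A} m Γ-inv Φ-inv step c =
  sym (ℕₚ.+-cancelˡ-≡ A _ _ (trans (step c) (trans (ℕₚ.+-comm _ (Γ c)) (cong (ℕ._+ Φ (c + p)) (sym A≡Γ)))))
  where
  open ≡-Reasoning
  lemma : ∀ c j p → c + j * p + p ≡ c + (+ 1 + j) * p
  lemma = solve-∀
  iterate : ∀ j → j ℕ.* A ℕ.+ Φ c ≡ Φ (c + + j * p) ℕ.+ j ℕ.* Γ c
  iterate zero    = trans (cong Φ (sym (ℤₚ.+-identityʳ c))) (sym (ℕₚ.+-identityʳ _))
  iterate (suc j) = begin
    A ℕ.+ j ℕ.* A ℕ.+ Φ c                           ≡⟨ ℕₚ.+-assoc A _ _ ⟩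
    A ℕ.+ (j ℕ.* A ℕ.+ Φ c)                         ≡⟨ cong (A ℕ.+_) (iterate j) ⟩
    A ℕ.+ (Φ (c + + j * p) ℕ.+ j ℕ.* Γ c)           ≡⟨ ℕₚ.+-assoc A _ _ ⟨
    A ℕ.+ Φ (c + + j * p) ℕ.+ j ℕ.* Γ c             ≡⟨ cong (ℕ._+ j ℕ.* Γ c) (step (c + + j * p)) ⟩
    Φ (c + + j * p + p) ℕ.+ Γ (c + + j * p) ℕ.+ j ℕ.* Γ c
      ≡⟨ cong (ℕ._+ j ℕ.* Γ c) (cong₂ ℕ._+_ (cong Φ (lemma c (+ j) p)) (invariant-* Γ-inv (+ j) c)) ⟩
    Φ (c + + suc j * p) ℕ.+ Γ c ℕ.+ j ℕ.* Γ c       ≡⟨ ℕₚ.+-assoc (Φ (c + + suc j * p)) (Γ c) _ ⟩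
    Φ (c + + suc j * p) ℕ.+ (Γ c ℕ.+ j ℕ.* Γ c)     ∎
  A≡Γ : A ≡ Γ c
  A≡Γ = ℕₚ.*-cancelˡ-≡ _ _ m (ℕₚ.+-cancelʳ-≡ (Φ c) _ _
    (trans (iterate m) (trans (cong (ℕ._+ m ℕ.* Γ c) (Φ-inv c)) (ℕₚ.+-comm (Φ c) _))))

-- The lengths n, n + p, ..., n + (T - 1) p. When ρ^p = ±1, the rows of these lengths in a triangle
-- carry the same power of ρ up to sign.
class : ℕ → ℕ → ℕ → (ℤ → ℕ) → ℕ
class p T n f = ∑ T (λ t → row (n ℕ.+ t ℕ.* p) f)

class-cong : ∀ p T n {f g} → (∀ x → f x ≡ g x) → class p T n f ≡ class p T n g
class-cong p T n f≡g = ∑-cong′ T (λ t → row-cong (n ℕ.+ t ℕ.* p) f≡g)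

-- The sum of the rows lengthened by p is computed twice: as the same class with its first row
-- exchanged for the row of length n + T p, and row by row with `row-shift`. Comparing the results
-- gives the relation that `telescope` asks for.
class-invariant : ∀ {m} .{{_ : NonZero m}} {p T n f} → Coprime 2 m → m ∣ T ℕ.* p → Periodic m f →
  Invariant (+ p) (class p T n ∘ translate f)
class-invariant {m} {p} {T} {n} {f} m-odd m∣Tp per = telescope m Γ-invariant
  (λ c → class-cong p T n (λ x → per (+ˡ-≈ x (+-modulus-* c (+ p)))))
  step
  where
  open ≡-Reasoning
  s = T ℕ.* p

  -- The p lowest terms, split off from the row of length n + (t + 1) p.
  tail : ℕ → (ℤ → ℕ) → ℕ
  tail t h = ∑ p (λ k → h (+ p - (+ 1 + + 2 * + k) - + (n ℕ.+ t ℕ.* p)))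

  Γ : ℤ → ℕ
  Γ c = ∑ T (λ t → tail t (translate f c))

  Γ-invariant : Invariant (+ p) Γ
  -- Translation by p turns the tail of index t + 1 into the tail of index t, and the index may be
  -- rotated because T p ≡ 0 modulo m.
  Γ-invariant c = trans
    (sym (∑-cyclic T (λ t → tail t (translate f (c + + p)))
      (∑-cong′ p (λ k → per (+ʳ-≈ (c + + p) (+ˡ-≈ (+ p - (+ 1 + + 2 * + k)) (-‿≈ (+ˡ-≈ (+ n) (∣⇒+≈0 m∣Tp)))))))))
    (∑-cong′ T (λ t → ∑-cong′ p (λ k → cong f (lemma (+ p) (+ n) (+ (t ℕ.* p)) (+ k) c))))
    where
    lemma : ∀ p n z k c →
      p - (+ 1 + + 2 * k) - (n + (p + z)) + (c + p) ≡ p - (+ 1 + + 2 * k) - (n + z) + c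
    lemma = solve-∀

  step : ∀ c → descend s f (+ 0) ℕ.+ class p T n (translate f c) ≡ class p T n (translate f (c + + p)) ℕ.+ Γ c
  step c = begin
    descend s f (+ 0) ℕ.+ ∑ T R                     ≡⟨ shifted ⟨
    ∑ T (R ∘ suc)                                   ≡⟨ ∑-cong′ T split ⟩
    ∑ T (λ t → row (n ℕ.+ t ℕ.* p) (translate f (c + + p)) ℕ.+ tail t h)
                                                    ≡⟨ ∑-+ T _ _ ⟩
    class p T n (translate f (c + + p)) ℕ.+ Γ c     ∎
    where
    h = translate f c
    R = λ t → row (n ℕ.+ t ℕ.* p) h
    head : R T ≡ descend s f (+ 0) ℕ.+ R 0
    head = trans (row-extend m-odd m∣Tp (periodic-translate c per) n)
      (cong₂ ℕ._+_
        -- `descend-const` removes c: the constant A of `telescope` has to serve all translates.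
        (trans (∑-cong′ s (λ k → cong f (lemma (+ k) c))) (descend-const m-odd m∣Tp per c))
        (cong (λ N → row N h) (sym (ℕₚ.+-identityʳ n))))
      where
      lemma : ∀ k c → + 0 - + 2 * k + c ≡ c - + 2 * k
      lemma = solve-∀
    shifted : ∑ T (R ∘ suc) ≡ descend s f (+ 0) ℕ.+ ∑ T R
    shifted = ℕₚ.+-cancelˡ-≡ (R 0) _ _ (begin
      R 0 ℕ.+ ∑ T (R ∘ suc)                     ≡⟨ ∑-last T R ⟩
      ∑ T R ℕ.+ R T                             ≡⟨ ℕₚ.+-comm (∑ T R) (R T) ⟩
      R T ℕ.+ ∑ T R                             ≡⟨ cong (ℕ._+ ∑ T R) (trans head (ℕₚ.+-comm _ (R 0))) ⟩
      R 0 ℕ.+ descend s f (+ 0) ℕ.+ ∑ T R       ≡⟨ ℕₚ.+-assoc (R 0) _ _ ⟩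
      R 0 ℕ.+ (descend s f (+ 0) ℕ.+ ∑ T R)     ∎)
    lemma : ∀ x c p → x + p + c ≡ x + (c + p)
    lemma = solve-∀
    split : ∀ t → R (suc t) ≡ row (n ℕ.+ t ℕ.* p) (translate f (c + + p)) ℕ.+ tail t h
    split t = begin
      row (n ℕ.+ (p ℕ.+ t ℕ.* p)) h
        ≡⟨ cong (λ N → row N h) (trans (cong (n ℕ.+_) (ℕₚ.+-comm p _)) (sym (ℕₚ.+-assoc n _ p))) ⟩
      row (n ℕ.+ t ℕ.* p ℕ.+ p) h
        ≡⟨ row-shift (n ℕ.+ t ℕ.* p) p h ⟩
      row (n ℕ.+ t ℕ.* p) (translate h (+ p)) ℕ.+ tail t h
        ≡⟨ cong (ℕ._+ tail t h) (row-cong (n ℕ.+ t ℕ.* p) (λ x → cong f (lemma x c (+ p)))) ⟩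
      row (n ℕ.+ t ℕ.* p) (translate f (c + + p)) ℕ.+ tail t h ∎

-- Orders of units, and translation invariance of triangles

^-distribʳ-* : ∀ n x y → (x * y) ^ n ≡ x ^ n * y ^ n
^-distribʳ-* zero    x y = refl
^-distribʳ-* (suc n) x y = trans (cong (x * y *_) (^-distribʳ-* n x y)) (lemma x y (x ^ n) (y ^ n))
  where
  lemma : ∀ x y u v → x * y * (u * v) ≡ x * u * (y * v)
  lemma = solve-∀

^-inverse : ∀ {m ρ τ} → ρ * τ ≈ + 1 [ m ] → ∀ n → ρ ^ n * τ ^ n ≈ + 1 [ m ]
^-inverse {m} {ρ} {τ} inv n = begin
  ρ ^ n * τ ^ n ≡⟨ ^-distribʳ-* n ρ τ ⟨
  (ρ * τ) ^ n   ≈⟨ ^-≈ n inv ⟩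
  (+ 1) ^ n     ≡⟨ ℤₚ.^-zeroˡ n ⟩
  + 1           ∎
  where open ≈-Reasoning m

IsSign : ℕ → ℤ → Set
IsSign m e = e ≈ + 1 [ m ] ⊎ e ≈ - + 1 [ m ]

sign-* : ∀ {m x y} → IsSign m x → IsSign m y → IsSign m (x * y)
sign-* (inj₁ p) (inj₁ q) = inj₁ (*-≈ p q)
sign-* (inj₁ p) (inj₂ q) = inj₂ (*-≈ p q)
sign-* (inj₂ p) (inj₁ q) = inj₂ (*-≈ p q)
sign-* (inj₂ p) (inj₂ q) = inj₁ (*-≈ p q)

sign-^ : ∀ {m x} n → IsSign m x → IsSign m (x ^ n)
sign-^ zero    p = inj₁ ≈-refl
sign-^ (suc n) p = sign-* p (sign-^ n p)

sign-resp : ∀ {m x y} → x ≈ y [ m ] → IsSign m x → IsSign m y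
sign-resp x≈y (inj₁ p) = inj₁ (≈-trans (≈-sym x≈y) p)
sign-resp x≈y (inj₂ p) = inj₂ (≈-trans (≈-sym x≈y) p)

-- A sign is its own inverse, so x ≈ (x y) y is a product of two signs.
sign-cancelʳ : ∀ {m x} y → IsSign m (x * y) → IsSign m y → IsSign m x
sign-cancelʳ {m} {x} y xy y± = sign-resp xy²≈x (sign-* xy y±)
  where
  square : IsSign m y → y * y ≈ + 1 [ m ]
  square (inj₁ p) = *-≈ p p
  square (inj₂ p) = *-≈ p p
  xy²≈x : x * y * y ≈ x [ m ]
  xy²≈x = ≈-trans (≈-reflexive (ℤₚ.*-assoc x y y))
            (≈-trans (*ˡ-≈ x (square y±)) (≈-reflexive (ℤₚ.*-identityʳ x)))

sign-multiple : ∀ {m ρ} k {p} → IsSign m (ρ ^ p) → IsSign m (ρ ^ (k ℕ.* p))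
sign-multiple {m} {ρ} k {p} ρᵖ = subst (IsSign m)
  (trans (ℤₚ.^-*-assoc ρ p k) (cong (ρ ^_) (ℕₚ.*-comm p k))) (sign-^ k ρᵖ)

-- The exponents that give ±1 are closed under multiples and, by `sign-cancelʳ`, under differences,
-- so the Bézout identity reaches the greatest common divisor.
sign-GCD : ∀ {m ρ k p d} → GCD k p d → IsSign m (ρ ^ k) → IsSign m (ρ ^ p) → IsSign m (ρ ^ d)
sign-GCD {m} {ρ} {k} {p} {d} isGCD ρᵏ ρᵖ with Bézout.identity isGCD
... | Bézout.+- i j eq = sign-cancelʳ (ρ ^ (j ℕ.* p))
  (subst (IsSign m) (trans (cong (ρ ^_) (sym eq)) (ℤₚ.^-distribˡ-+-* ρ d _)) (sign-multiple i ρᵏ))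
  (sign-multiple j ρᵖ)
... | Bézout.-+ i j eq = sign-cancelʳ (ρ ^ (i ℕ.* k))
  (subst (IsSign m) (trans (cong (ρ ^_) (sym eq)) (ℤₚ.^-distribˡ-+-* ρ d _)) (sign-multiple j ρᵖ))
  (sign-multiple i ρᵏ)

row-sign : ∀ {m e f} → IsSign m e → Periodic m f → ∀ n → row n (λ x → f (e * x)) ≡ row n f
row-sign (inj₁ e≈1) per n =
  row-cong n (λ x → per (≈-trans (*ʳ-≈ x e≈1) (≈-reflexive (ℤₚ.*-identityˡ x))))
row-sign {f = f} (inj₂ e≈-1) per n =
  trans (row-cong n (λ x → per (≈-trans (*ʳ-≈ x e≈-1) (≈-reflexive (ℤₚ.-1*i≡-i x))))) (row-neg n f)

residue-≈ : ∀ {m} .{{_ : NonZero m}} {x y} → x %ℕ m ≡ y %ℕ m → x ≈ y [ m ]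
residue-≈ {m} {x} {y} eq = ≈-trans (toResidue x)
  (≈-trans (≈-reflexive (cong +_ eq)) (≈-sym (toResidue y)))
  where
  toResidue : ∀ x → x ≈ + (x %ℕ m) [ m ]
  toResidue x = multiple (x /ℕ m) (a≡a%ℕn+[a/ℕn]*n x m)

residue≢0 : ∀ {m} .{{_ : NonZero m}} {x y} → 1 < m → x * y ≈ + 1 [ m ] → x %ℕ m ≢ 0
residue≢0 {m} {x} {y} 1<m xy≈1 eq = ℕₚ.≤⇒≯ (∣⇒≤ (≈0⇒∣ {m} {+ 1} 1≈0)) 1<m
  where
  1≈0 : + 1 ≈ + 0 [ m ]
  1≈0 = ≈-trans (≈-sym xy≈1) (*ʳ-≈ y (residue-≈ {m} {x} {+ 0} (trans eq (sym (m<n⇒m%n≡m (ℕ.>-nonZero⁻¹ m))))))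

-- Taking predecessors places the nonzero residues modulo m in m - 1 boxes, one fewer than the
-- powers to be distributed by the pigeonhole principle.
pred-injective : ∀ {a b} → a ≢ 0 → b ≢ 0 → ℕ.pred a ≡ ℕ.pred b → a ≡ b
pred-injective {zero}          a≢0 _   _    = contradiction refl a≢0
pred-injective {suc _} {zero}  _   b≢0 _    = contradiction refl b≢0
pred-injective {suc _} {suc _} _   _   refl = refl

pred-mono-< : ∀ {n m} → n ≢ 0 → n < m → ℕ.pred n < ℕ.pred m
pred-mono-< {zero}  n≢0 _         = contradiction refl n≢0
pred-mono-< {suc n} n≢0 (s≤s n<m) = n<m

-- The m powers ρ⁰, …, ρᵐ⁻¹ have nonzero residues, so two of them agree.
short-period : ∀ {m} .{{_ : NonZero m}} {ρ τ} → 1 < m → ρ * τ ≈ + 1 [ m ] →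
  ∃ λ k → 1 ≤ k × k < m × ρ ^ k ≈ + 1 [ m ]
short-period {m} {ρ} {τ} 1<m inv = found
  where
  nonzero : ∀ i → (ρ ^ i) %ℕ m ≢ 0
  nonzero i = residue≢0 {m} {ρ ^ i} {τ ^ i} 1<m (^-inverse {m} {ρ} {τ} inv i)

  box : Fin m → Fin (ℕ.pred m)
  box i = fromℕ< (pred-mono-< (nonzero (toℕ i)) (n%ℕd<d (ρ ^ toℕ i) m))

  found : ∃ λ k → 1 ≤ k × k < m × ρ ^ k ≈ + 1 [ m ]
  found with Finₚ.pigeonhole (ℕₚ.≤-reflexive (ℕₚ.suc-pred m)) box
  ... | i , j , i<j , eq = k , ℕₚ.m<n⇒0<n∸m i<j , ℕₚ.≤-<-trans (ℕₚ.m∸n≤m b a) (Finₚ.toℕ<n j) , ρᵏ≈1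
    where
    a = toℕ i
    b = toℕ j
    k = b ℕ.∸ a
    same : ρ ^ a ≈ ρ ^ b [ m ]
    same = residue-≈ (pred-injective (nonzero a) (nonzero b)
      (trans (sym (Finₚ.toℕ-fromℕ< _)) (trans (cong toℕ eq) (Finₚ.toℕ-fromℕ< _))))
    open ≈-Reasoning m
    lemma : ∀ x y z → x * y * z ≡ x * (y * z)
    lemma = solve-∀
    ρᵏ≈1 : ρ ^ k ≈ + 1 [ m ]
    ρᵏ≈1 = begin
      ρ ^ k                   ≡⟨ ℤₚ.*-identityʳ (ρ ^ k) ⟨
      ρ ^ k * + 1             ≈⟨ *ˡ-≈ (ρ ^ k) (^-inverse inv a) ⟨
      ρ ^ k * (ρ ^ a * τ ^ a) ≡⟨ lemma (ρ ^ k) (ρ ^ a) (τ ^ a) ⟨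
      ρ ^ k * ρ ^ a * τ ^ a   ≡⟨ cong (_* τ ^ a) (ℤₚ.^-distribˡ-+-* ρ k a) ⟨
      ρ ^ (k ℕ.+ a) * τ ^ a   ≡⟨ cong (λ n → ρ ^ n * τ ^ a) (ℕₚ.m∸n+n≡m (ℕₚ.<⇒≤ i<j)) ⟩
      ρ ^ b * τ ^ a           ≈⟨ *ʳ-≈ (τ ^ a) same ⟨
      ρ ^ a * τ ^ a           ≈⟨ ^-inverse inv a ⟩
      + 1                     ∎

-- The longest row has length s - 1, and row 0 is empty: a triangle of size s is therefore
-- `triangle ρ (suc s)`. An arbitrary f instead of the indicator of a residue leaves room for
-- averaging.
triangle : ℤ → ℕ → (ℤ → ℕ) → ℕ
triangle ρ s f = ∑ s (λ n → row n (λ x → f (ρ ^ n * x)))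

triangle-cong : ∀ ρ s {f g} → (∀ x → f x ≡ g x) → triangle ρ s f ≡ triangle ρ s g
triangle-cong ρ s f≡g = ∑-cong′ s (λ n → row-cong n (λ x → f≡g (ρ ^ n * x)))

triangle-∑ : ∀ ρ s N (f : ℕ → ℤ → ℕ) → triangle ρ s (λ x → ∑ N (λ j → f j x)) ≡ ∑ N (λ j → triangle ρ s (f j))
triangle-∑ ρ s N f = trans (∑-cong′ s (λ n → ∑-comm n N _)) (∑-comm s N _)

-- The lengths below T p are grouped by their residue i modulo p. Within a group the factor beyond
-- ρ^i is a sign, absorbed by the symmetry of the row.
triangle-classes : ∀ {m ρ p f} T → IsSign m (ρ ^ p) → Periodic m f →
  triangle ρ (T ℕ.* p) f ≡ ∑ p (λ i → class p T i (λ x → f (ρ ^ i * x)))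
triangle-classes {m} {ρ} {p} {f} T ρᵖ per = trans (∑-residues T p _) (∑-cong′ p (λ i → ∑-cong′ T (λ t →
  trans (row-cong (i ℕ.+ t ℕ.* p) (λ x → cong f (expand i t x)))
        (row-sign (sign-multiple t ρᵖ) (periodic-* (ρ ^ i) per) (i ℕ.+ t ℕ.* p)))))
  where
  expand : ∀ i t x → ρ ^ (i ℕ.+ t ℕ.* p) * x ≡ ρ ^ i * (ρ ^ (t ℕ.* p) * x)
  expand i t x = trans (cong (_* x) (ℤₚ.^-distribˡ-+-* ρ i (t ℕ.* p))) (ℤₚ.*-assoc (ρ ^ i) _ x)

-- In the class of i, translating f by p amounts to translating x ↦ f(ρ^i x + c) by τ^i p. This is
-- still a multiple of p, so `class-invariant` applies.
triangle-invariant-order : ∀ {m} .{{_ : NonZero m}} {ρ τ p s f} → Coprime 2 m → ρ * τ ≈ + 1 [ m ] →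
  p ∣ s → m ∣ s → IsSign m (ρ ^ p) → Periodic m f → Invariant (+ p) (triangle ρ s ∘ translate f)
triangle-invariant-order {m} {ρ} {τ} {p} {f = f} m-odd inv (divides T refl) m∣s ρᵖ per c = begin
  triangle ρ (T ℕ.* p) (translate f (c + + p))
    ≡⟨ triangle-classes T ρᵖ (periodic-translate (c + + p) per) ⟩
  ∑ p (λ i → class p T i (λ x → f (ρ ^ i * x + (c + + p))))
    ≡⟨ ∑-cong′ p (λ i → trans (class-cong p T i (λ x → per (pull i x)))
         (trans (invariant-* {+ p} {class p T i ∘ translate (h i)} (class-invariant {T = T} {i} m-odd m∣s (h-per i)) (τ ^ i) (+ 0))
                (class-cong p T i (λ x → cong (h i) (ℤₚ.+-identityʳ x))))) ⟩
  ∑ p (λ i → class p T i (h i))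
    ≡⟨ triangle-classes T ρᵖ (periodic-translate c per) ⟨
  triangle ρ (T ℕ.* p) (translate f c) ∎
  where
  open ≡-Reasoning
  h : ℕ → ℤ → ℕ
  h i x = f (ρ ^ i * x + c)
  h-per : ∀ i → Periodic m (h i)
  h-per i = periodic-* (ρ ^ i) (periodic-translate c per)
  lemma : ∀ r t x c p → r * (x + (+ 0 + t * p)) + c ≡ r * x + (c + r * t * p)
  lemma = solve-∀
  pull : ∀ i x → ρ ^ i * x + (c + + p) ≈ ρ ^ i * (x + (+ 0 + τ ^ i * + p)) + c [ m ]
  pull i x = ≈-sym (≈-trans (≈-reflexive (lemma (ρ ^ i) (τ ^ i) x c (+ p)))
    (+ˡ-≈ (ρ ^ i * x) (+ˡ-≈ c (≈-trans (*ʳ-≈ (+ p) (^-inverse inv i)) (≈-reflexive (ℤₚ.*-identityˡ (+ p)))))))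

-- A sum instead of a mean, so that the values stay in ℕ; the factor m is cancelled in
-- `triangle-invariant`.
average : ℕ → ℤ → (ℤ → ℕ) → ℤ → ℕ
average m p f x = ∑ m (λ j → f (x + + j * p))

-- Translation by p rotates the index j, since m p ≡ 0 modulo m.
average-invariant : ∀ {m f} p → Periodic m f → Invariant p (average m p f)
average-invariant {m} {f} p per x = trans (∑-cong′ m (λ j → cong f (lemma x p (+ j))))
  (∑-cyclic m (λ j → f (x + + j * p))
    (per (≈-trans (+-modulus-* x p) (≈-reflexive (sym (ℤₚ.+-identityʳ x))))))
  where
  lemma : ∀ x p j → x + p + j * p ≡ x + (+ 1 + j) * p
  lemma = solve-∀

average-periodic : ∀ {m p g f} → GCD p m g → Periodic m f → Periodic g (average m (+ p) f)
average-periodic {m} {p} isGCD per = invariant⇒periodic (invariant-GCD isGCD (average-invariant (+ p) per)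
  (λ x → ∑-cong′ m (λ j → per (+ʳ-≈ (+ j * + p) (+-modulus x)))))

triangle-average : ∀ {m ρ p s f} → Invariant p (triangle ρ s ∘ translate f) →
  ∀ c → triangle ρ s (translate (average m p f) c) ≡ m ℕ.* triangle ρ s (translate f c)
triangle-average {m} {ρ} {p} {s} {f} inv c = begin
  triangle ρ s (translate (average m p f) c)
    ≡⟨ triangle-∑ ρ s m (λ j x → f (x + c + + j * p)) ⟩
  ∑ m (λ j → triangle ρ s (λ x → f (x + c + + j * p)))
    ≡⟨ ∑-cong′ m (λ j → trans (triangle-cong ρ s (λ x → cong f (ℤₚ.+-assoc x c _)))
                              (invariant-* {p} {triangle ρ s ∘ translate f} inv (+ j) c)) ⟩
  ∑ m (λ _ → triangle ρ s (translate f c))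
    ≡⟨ ∑-const m _ ⟩
  m ℕ.* triangle ρ s (translate f c) ∎
  where open ≡-Reasoning

divisor-positive : ∀ {d n} → d ∣ n → 1 ≤ n → 1 ≤ d
divisor-positive {zero}  0∣n 1≤n = contradiction (sym (0∣⇒≡0 0∣n)) (ℕₚ.<⇒≢ 1≤n)
divisor-positive {suc _} _   _   = s≤s z≤n

-- A period k < m need not divide s, and p may exceed m; the greatest common divisor of k and p is
-- below m and divides s.
short-order : ∀ {m} .{{_ : NonZero m}} {ρ τ p s} → 1 < m → ρ * τ ≈ + 1 [ m ] → p ∣ s → IsSign m (ρ ^ p) →
  ∃ λ q → 1 ≤ q × q < m × q ∣ s × IsSign m (ρ ^ q)
short-order {m} {ρ} {τ} {p} {s} 1<m inv p∣s ρᵖ = reduce (short-period {m} {ρ} {τ} 1<m inv)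
  where
  reduce : (∃ λ k → 1 ≤ k × k < m × ρ ^ k ≈ + 1 [ m ]) → ∃ λ q → 1 ≤ q × q < m × q ∣ s × IsSign m (ρ ^ q)
  reduce (k , 1≤k , k<m , ρᵏ≈1) = build (mkGCD k p)
    where
    build : (∃ λ q → GCD k p q) → ∃ λ q → 1 ≤ q × q < m × q ∣ s × IsSign m (ρ ^ q)
    build (q , isGCD) =
      q ,
      divisor-positive (GCD.GCD.gcd∣m isGCD) 1≤k ,
      ℕₚ.≤-<-trans (∣⇒≤ {{ℕ.>-nonZero 1≤k}} (GCD.GCD.gcd∣m isGCD)) k<m ,
      ∣-trans (GCD.GCD.gcd∣n isGCD) p∣s ,
      sign-GCD {m} {ρ} isGCD (inj₁ ρᵏ≈1) ρᵖ

-- Well-founded induction on m for all f at once: the induction hypothesis is applied at the modulus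
-- g to the averaged function, with ρ, τ and s unchanged.
triangle-invariant : ∀ {m} → Acc _<_ m → .{{_ : NonZero m}} → ∀ {ρ τ p s f} → Coprime 2 m → ρ * τ ≈ + 1 [ m ] →
  p ∣ s → m ∣ s → IsSign m (ρ ^ p) → Periodic m f → Invariant (+ 1) (triangle ρ s ∘ translate f)
triangle-invariant {m} (acc rec) {ρ} {τ} {p₀} {s} {f} m-odd inv p₀∣s m∣s ρᵖ⁰ per c with 1 ℕₚ.<? m
-- Here m = 1, and a translation by 1 is a translation by m.
... | no 1≮m = triangle-cong ρ s (λ x → per (≈-trans (≈-reflexive (sym (ℤₚ.+-assoc x c (+ 1))))
        (subst (λ n → x + c + + n ≈ x + c [ m ]) (ℕₚ.≤-antisym (ℕₚ.≮⇒≥ 1≮m) (ℕ.>-nonZero⁻¹ m)) (+-modulus (x + c)))))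
... | yes 1<m = reduce (short-order {m} {ρ} {τ} {p₀} 1<m inv p₀∣s ρᵖ⁰)
  where
  Goal = triangle ρ s (translate f (c + + 1)) ≡ triangle ρ s (translate f c)
  descent : ∀ {p g} → GCD p m g → 1 ≤ p → p < m → p ∣ s → IsSign m (ρ ^ p) → Goal
  descent {p} {g} isGCD 1≤p p<m p∣s ρᵖ = ℕₚ.*-cancelˡ-≡ _ _ m (begin
    m ℕ.* triangle ρ s (translate f (c + + 1))             ≡⟨ total (c + + 1) ⟨
    triangle ρ s (translate (average m (+ p) f) (c + + 1)) ≡⟨ hyp ⟩
    triangle ρ s (translate (average m (+ p) f) c)         ≡⟨ total c ⟩
    m ℕ.* triangle ρ s (translate f c)                     ∎)
    where
    open ≡-Reasoning
    g∣m : g ∣ m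
    g∣m = GCD.GCD.gcd∣n isGCD
    -- The modulus drops because g divides p, which `short-order` has made smaller than m.
    g<m : g < m
    g<m = ℕₚ.≤-<-trans (∣⇒≤ {{ℕ.>-nonZero 1≤p}} (GCD.GCD.gcd∣m isGCD)) p<m
    g-odd : Coprime 2 g
    g-odd (d∣2 , d∣g) = m-odd (d∣2 , ∣-trans d∣g g∣m)
    hyp : triangle ρ s (translate (average m (+ p) f) (c + + 1)) ≡ triangle ρ s (translate (average m (+ p) f) c)
    hyp = triangle-invariant (rec g<m) {{ℕ.>-nonZero (divisor-positive (GCD.GCD.gcd∣m isGCD) 1≤p)}}
            {ρ} {τ} {p} {s} {average m (+ p) f} g-odd (≈-∣ g∣m inv) p∣s
            (∣-trans g∣m m∣s) (Sum.map (≈-∣ g∣m) (≈-∣ g∣m) ρᵖ) (average-periodic isGCD per) c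
    total : ∀ c → triangle ρ s (translate (average m (+ p) f) c) ≡ m ℕ.* triangle ρ s (translate f c)
    total = triangle-average {m} {ρ} {+ p} {s} {f}
      (triangle-invariant-order {m} {ρ} {τ} {p} {s} {f} m-odd inv p∣s m∣s ρᵖ per)
  reduce : (∃ λ p → 1 ≤ p × p < m × p ∣ s × IsSign m (ρ ^ p)) → Goal
  reduce (p , 1≤p , p<m , p∣s , ρᵖ) = descent (proj₂ (mkGCD p m)) 1≤p p<m p∣s ρᵖ

module _ {m : ℕ} .{{_ : NonZero m}} {ρ τ : ℤ} {f : ℤ → ℕ} (m-odd : Coprime 2 m) (inv : ρ * τ ≈ + 1 [ m ])
         (per : Periodic m f) where

  -- A row whose length is a multiple of m is a full progression of step -2. Translation by 1
  -- outside the factor ρ^s is translation by τ^s inside it, which such a progression does not see.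
  row-invariant : ∀ {s} → m ∣ s → Invariant (+ 1) (λ c → row s (λ x → f (ρ ^ s * x + c)))
  row-invariant {s} m∣s c = begin
    row s (λ x → f (ρ ^ s * x + (c + + 1)))    ≡⟨ row-cong s (λ x → per (pull x)) ⟩
    row s (translate h (τ ^ s))                ≡⟨ whole (periodic-translate (τ ^ s) h-per) ⟩
    descend s (translate h (τ ^ s)) (+ 0)      ≡⟨ ∑-cong′ s (λ k → cong h (lemma₂ (+ k) (τ ^ s))) ⟩
    descend s h (τ ^ s)                        ≡⟨ descend-const m-odd m∣s h-per (τ ^ s) ⟩
    descend s h (+ 0)                          ≡⟨ whole h-per ⟨
    row s h                                    ∎
    where
    open ≡-Reasoning
    h : ℤ → ℕ
    h x = f (ρ ^ s * x + c)
    h-per : Periodic m h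
    h-per = periodic-* (ρ ^ s) (periodic-translate c per)
    whole : ∀ {g} → Periodic m g → row s g ≡ descend s g (+ 0)
    whole g-per = trans (row-extend m-odd m∣s g-per 0) (ℕₚ.+-identityʳ _)
    lemma₁ : ∀ r t x c → r * (x + t) + c ≡ r * x + (c + r * t)
    lemma₁ = solve-∀
    lemma₂ : ∀ k t → + 0 - + 2 * k + t ≡ t - + 2 * k
    lemma₂ = solve-∀
    pull : ∀ x → ρ ^ s * x + (c + + 1) ≈ ρ ^ s * (x + τ ^ s) + c [ m ]
    pull x = ≈-sym (≈-trans (≈-reflexive (lemma₁ (ρ ^ s) (τ ^ s) x c))
               (+ˡ-≈ (ρ ^ s * x) (+ˡ-≈ c (^-inverse {m} {ρ} {τ} inv s))))

  -- If p and m divide s + 1, the number of rows including the empty one, `triangle-invariant`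
  -- applies directly. If they divide s, the longest row is split off and handled by
  -- `row-invariant`.
  triangle-const : ∀ {p s} → IsSign m (ρ ^ p) → (p ∣ s × m ∣ s) ⊎ (p ∣ suc s × m ∣ suc s) →
    ∀ c → triangle ρ (suc s) (translate f c) ≡ triangle ρ (suc s) (translate f (+ 0))
  triangle-const {p} {s} ρᵖ size c = trans (cong (triangle ρ (suc s) ∘ translate f) (lemma c))
    (invariant-* {+ 1} {triangle ρ (suc s) ∘ translate f} (by-1 size) c (+ 0))
    where
    lemma : ∀ c → c ≡ + 0 + c * + 1
    lemma = solve-∀
    by-1 : (p ∣ s × m ∣ s) ⊎ (p ∣ suc s × m ∣ suc s) → Invariant (+ 1) (triangle ρ (suc s) ∘ translate f)
    by-1 (inj₂ (p∣s , m∣s)) = triangle-invariant (<-wellFounded m) {ρ} {τ} {p} {suc s} m-odd inv p∣s m∣s ρᵖ per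
    by-1 (inj₁ (p∣s , m∣s)) c = begin
      triangle ρ (suc s) (translate f (c + + 1))
        ≡⟨ ∑-last s (λ n → row n (λ x → f (ρ ^ n * x + (c + + 1)))) ⟩
      triangle ρ s (translate f (c + + 1)) ℕ.+ row s (λ x → f (ρ ^ s * x + (c + + 1)))
        ≡⟨ cong₂ ℕ._+_ (triangle-invariant (<-wellFounded m) {ρ} {τ} {p} {s} m-odd inv p∣s m∣s ρᵖ per c)
                       (row-invariant m∣s c) ⟩
      triangle ρ s (translate f c) ℕ.+ row s (λ x → f (ρ ^ s * x + c))
        ≡⟨ ∑-last s (λ n → row n (λ x → f (ρ ^ n * x + c))) ⟨
      triangle ρ (suc s) (translate f c) ∎
      where open ≡-Reasoning

-- Counting in a triangle and closed form of the orbit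

-- Defined through `does`, the Boolean on which `filter` branches.
indicator : ∀ {ℓ} {P : Set ℓ} → Dec P → ℕ
indicator P? = if does P? then 1 else 0

module _ {a ℓ} {A : Set a} {P : Pred A ℓ} (P? : Decidable P) where

  length-filter-∷ : ∀ x xs → length (filter P? (x ∷ xs)) ≡ indicator (P? x) ℕ.+ length (filter P? xs)
  length-filter-∷ x xs with does (P? x)
  ... | true  = refl
  ... | false = refl

  length-filter-map : ∀ (g : ℕ → A) h n →
    length (filter P? (map g (applyUpTo h n))) ≡ ∑ n (λ i → indicator (P? (g (h i))))
  length-filter-map g h zero    = refl
  length-filter-map g h (suc n) = trans (length-filter-∷ (g (h 0)) _)
    (cong (indicator (P? (g (h 0))) ℕ.+_) (length-filter-map g (h ∘ suc) n))

  length-filter-concatMap : ∀ (g : ℕ → List A) h n →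
    length (filter P? (concatMap g (applyUpTo h n))) ≡ ∑ n (λ i → length (filter P? (g (h i))))
  length-filter-concatMap g h zero    = refl
  length-filter-concatMap g h (suc n) = begin
    length (filter P? (g (h 0) ++ rest))                      ≡⟨ cong length (filter-++ P? (g (h 0)) rest) ⟩
    length (filter P? (g (h 0)) ++ filter P? rest)            ≡⟨ length-++ (filter P? (g (h 0))) ⟩
    length (filter P? (g (h 0))) ℕ.+ length (filter P? rest)
      ≡⟨ cong (length (filter P? (g (h 0))) ℕ.+_) (length-filter-concatMap g (h ∘ suc) n) ⟩
    ∑ (suc n) (λ i → length (filter P? (g (h i))))            ∎
    where
    open ≡-Reasoning
    rest = concatMap g (applyUpTo (h ∘ suc) n)

length-filter-offsets : ∀ {ℓ} {P : Pred (ℕ × ℕ) ℓ} (P? : Decidable P) s →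
  length (filter P? (offsets s)) ≡ ∑ s (λ k₂ → ∑ (s ℕ.∸ k₂) (λ k₁ → indicator (P? (k₁ , k₂))))
length-filter-offsets P? s = trans
  (length-filter-concatMap P? (λ k₂ → map (λ k₁ → (k₁ , k₂)) (upTo (s ℕ.∸ k₂))) (λ i → i) s)
  (∑-cong′ s (λ k₂ → length-filter-map P? (λ k₁ → (k₁ , k₂)) (λ i → i) (s ℕ.∸ k₂)))

δ : ℕ → ℤ → ℕ
δ m x = indicator (m ∣? ℤ.∣ x ∣)

δ-⇔ : ∀ {m x y} → (x ≈ + 0 [ m ] → y ≈ + 0 [ m ]) → (y ≈ + 0 [ m ] → x ≈ + 0 [ m ]) → δ m x ≡ δ m y
δ-⇔ {m} {x} {y} to from = cong (if_then 1 else 0)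
  (does-⇔ (mk⇔ (λ m∣x → ≈0⇒∣ (to (∣⇒≈0 m∣x))) (λ m∣y → ≈0⇒∣ (from (∣⇒≈0 m∣y)))) (m ∣? ℤ.∣ x ∣) (m ∣? ℤ.∣ y ∣))

δ-periodic : ∀ {m} → Periodic m (δ m)
δ-periodic x≈y = δ-⇔ (≈-trans (≈-sym x≈y)) (≈-trans x≈y)

odd⇒coprime-2 : ∀ {m} → ¬ (2 ∣ m) → Coprime 2 m
odd⇒coprime-2 ¬2∣m {zero}              (0∣2 , _) = contradiction (0∣⇒≡0 0∣2) λ ()
odd⇒coprime-2 ¬2∣m {suc zero}          _         = refl
odd⇒coprime-2 ¬2∣m {suc (suc zero)}    (_ , 2∣m) = contradiction 2∣m ¬2∣m
odd⇒coprime-2 ¬2∣m {suc (suc (suc d))} (d∣2 , _) = contradiction (∣⇒≤ d∣2) λ { (s≤s (s≤s ())) }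

halve-≈0 : ∀ {m} x → Coprime 2 m → + 2 * x ≈ + 0 [ m ] → x ≈ + 0 [ m ]
halve-≈0 {m} x m-odd 2x≈0 = ∣⇒≈0 (coprime-divisor (Coprimality.sym m-odd)
  (subst (m ∣_) (ℤₚ.abs-* (+ 2) x) (≈0⇒∣ 2x≈0)))

-- `E` stands for the entries of a triangle of either orientation; the last hypothesis holds all the
-- information taken from the orbit.
module _ {m : ℕ} .{{_ : NonZero m}} {ρ τ : ℤ} {p s : ℕ} {u t : ℤ} (E : ℕ × ℕ → ℤ) (m-odd : Coprime 2 m)
         (ρτ≈1 : ρ * τ ≈ + 1 [ m ]) (ut≈1 : u * t ≈ + 1 [ m ]) (ρᵖ : IsSign m (ρ ^ p))
         (size : (p ∣ s × m ∣ s) ⊎ (p ∣ suc s × m ∣ suc s))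
         (2E≈ : ∀ k₁ k₂ → k₁ ℕ.+ k₂ < s →
                + 2 * E (k₁ , k₂) ≈ u * (ρ ^ (s ℕ.∸ k₂) * centred (s ℕ.∸ k₂) k₁) [ m ]) where

  count : ℤ → ℕ
  count c = length (filter (λ k → m ∣? ℤ.∣ E k - c ∣) (offsets s))

  -- Since 2 and u are units, E ≡ c holds exactly when u (ρ^n x - 2 t c) ≡ 0, where x is the centred
  -- term and t inverts u. A change of c thus becomes a translation.
  count-triangle : ∀ c → count c ≡ triangle ρ (suc s) (translate (λ x → δ m (u * x)) (- (+ 2 * t * c)))
  count-triangle c = begin
    count c
      ≡⟨ length-filter-offsets (λ k → m ∣? ℤ.∣ E k - c ∣) s ⟩
    ∑ s (λ k₂ → ∑ (s ℕ.∸ k₂) (λ k₁ → δ m (E (k₁ , k₂) - c)))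
      ≡⟨ ∑-cong s (λ k₂ k₂<s → ∑-cong (s ℕ.∸ k₂) (λ k₁ k₁<n → entry-δ k₁ k₂ (inside k₁ k₂ k₂<s k₁<n))) ⟩
    ∑ s (λ k₂ → G (s ℕ.∸ k₂))
      -- The row at depth k₂ has length s - k₂; written as a successor, this length fits the
      -- reversal that sorts the rows by length.
      ≡⟨ ∑-cong s (λ k₂ k₂<s → cong G (ℕₚ.+-∸-assoc 1 k₂<s)) ⟩
    ∑ s (λ k₂ → G (suc (s ℕ.∸ suc k₂)))
      ≡⟨ ∑-reverse s (G ∘ suc) ⟩
    -- The triangle has one more term, the empty row of length 0, which vanishes by computation.
    ∑ s (G ∘ suc) ∎
    where
    open ≡-Reasoning
    G : ℕ → ℕ
    G n = row n (λ x → δ m (u * (ρ ^ n * x + - (+ 2 * t * c))))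
    inside : ∀ k₁ k₂ → k₂ < s → k₁ < s ℕ.∸ k₂ → k₁ ℕ.+ k₂ < s
    inside k₁ k₂ k₂<s k₁<n = subst (k₁ ℕ.+ k₂ <_) (ℕₚ.m∸n+n≡m (ℕₚ.<⇒≤ k₂<s)) (ℕₚ.+-monoˡ-< k₂ k₁<n)
    lemma₁ : ∀ e c → + 2 * (e - c) ≡ + 2 * e + - (+ 2 * + 1 * c)
    lemma₁ = solve-∀
    lemma₂ : ∀ u x t c → u * x + - (+ 2 * (u * t) * c) ≡ u * (x + - (+ 2 * t * c))
    lemma₂ = solve-∀
    entry-δ : ∀ k₁ k₂ → k₁ ℕ.+ k₂ < s →
      δ m (E (k₁ , k₂) - c) ≡ δ m (u * (ρ ^ (s ℕ.∸ k₂) * centred (s ℕ.∸ k₂) k₁ + - (+ 2 * t * c)))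
    entry-δ k₁ k₂ k< = trans (δ-⇔ {m} {e - c} {+ 2 * (e - c)} (*ˡ-≈ (+ 2)) (halve-≈0 (e - c) m-odd))
      (δ-periodic {m} (≈-trans (≈-reflexive (lemma₁ e c))
        (≈-trans (+-≈ (2E≈ k₁ k₂ k<) (-‿≈ (*ʳ-≈ c (*ˡ-≈ (+ 2) (≈-sym ut≈1)))))
                 (≈-reflexive (lemma₂ u (ρ ^ (s ℕ.∸ k₂) * centred (s ℕ.∸ k₂) k₁) t c)))))
      where e = E (k₁ , k₂)

  count-const : ∀ c c′ → count c ≡ count c′
  count-const c c′ = trans (to-0 c) (sym (to-0 c′))
    where
    f : ℤ → ℕ
    f x = δ m (u * x)
    to-0 : ∀ c → count c ≡ triangle ρ (suc s) (translate f (+ 0))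
    to-0 c = trans (count-triangle c)
      (triangle-const {m} {ρ} {τ} {f} m-odd ρτ≈1 (λ x≈y → δ-periodic {m} (*ˡ-≈ u x≈y)) ρᵖ size _)

-- Antisymmetry of the first row fixes B ≡ −(s − 1)D, so that each row is centred at 0.
rows-centred : ∀ {m s ς ς′ B D} {e : ℕ → ℕ} (E : ℕ × ℕ → ℤ) → Coprime 2 m → ς * ς′ ≈ + 1 [ m ] → 1 ≤ s →
  (∀ k₁ k₂ → k₁ ℕ.+ k₂ < s → + 2 * E (k₁ , k₂) ≈ ς ^ e k₂ * (B + (+ 2 * + k₁ + + k₂) * D) [ m ]) →
  E (0 , 0) + E (s ℕ.∸ 1 , 0) ≈ + 0 [ m ] →
  ∀ k₁ k₂ → k₁ ℕ.+ k₂ < s → + 2 * E (k₁ , k₂) ≈ - D * (ς ^ e k₂ * centred (s ℕ.∸ k₂) k₁) [ m ]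
rows-centred {m} {suc s} {ς} {ς′} {B} {D} {e} E m-odd inv (s≤s z≤n) 2E≈ antisym k₁ k₂ k< = begin
  + 2 * E (k₁ , k₂)                                   ≈⟨ 2E≈ k₁ k₂ k< ⟩
  P * (B + (+ 2 * + k₁ + + k₂) * D)                   ≡⟨ lemma₁ P B D (+ s) (+ k₁) (+ k₂) ⟩
  P * (B + + s * D + (+ 2 * + k₁ + + k₂ - + s) * D)   ≈⟨ *ˡ-≈ P (+ʳ-≈ ((+ 2 * + k₁ + + k₂ - + s) * D) B≈) ⟩
  P * (+ 0 + (+ 2 * + k₁ + + k₂ - + s) * D)           ≡⟨ final ⟩
  - D * (P * centred (suc s ℕ.∸ k₂) k₁)               ∎
  where
  open ≈-Reasoning m
  P = ς ^ e k₂
  Q = ς ^ e 0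
  lemma₁ : ∀ P B D s k₁ k₂ → P * (B + (+ 2 * k₁ + k₂) * D) ≡ P * (B + s * D + (+ 2 * k₁ + k₂ - s) * D)
  lemma₁ = solve-∀
  lemma₂ : ∀ P D n k₁ k₂ s → + 1 + s ≡ n + k₂ →
    P * (+ 0 + (+ 2 * k₁ + k₂ - s) * D) ≡ - D * (P * (n - (+ 1 + + 2 * k₁)))
  lemma₂ P D n k₁ k₂ s eq = trans (cong (λ z → P * (+ 0 + (+ 2 * k₁ + k₂ - z) * D)) s≡) (rearrange P D n k₁ k₂)
    where
    cancel : ∀ s → s ≡ + 1 + s - + 1
    cancel = solve-∀
    s≡ : s ≡ n + k₂ - + 1
    s≡ = trans (cancel s) (cong (_- + 1) eq)
    rearrange : ∀ P D n k₁ k₂ →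
      P * (+ 0 + (+ 2 * k₁ + k₂ - (n + k₂ - + 1)) * D) ≡ - D * (P * (n - (+ 1 + + 2 * k₁)))
    rearrange = solve-∀
  final : P * (+ 0 + (+ 2 * + k₁ + + k₂ - + s) * D) ≡ - D * (P * centred (suc s ℕ.∸ k₂) k₁)
  final = lemma₂ P D (+ (suc s ℕ.∸ k₂)) (+ k₁) (+ k₂) (+ s)
    (cong +_ (sym (ℕₚ.m∸n+n≡m (ℕₚ.≤-trans (ℕₚ.m≤n+m k₂ k₁) (ℕₚ.<⇒≤ k<)))))
  lemma₃ : ∀ Q B D s → + 2 * (Q * (B + s * D)) ≡ Q * (B + (+ 2 * + 0 + + 0) * D) + Q * (B + (+ 2 * s + + 0) * D)
  lemma₃ = solve-∀
  lemma₄ : ∀ x y → + 2 * x + + 2 * y ≡ + 2 * (x + y)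
  lemma₄ = solve-∀
  -- Here s is the size minus 1; the doubled end entries of the first row add up to 2 Q (B + s D).
  QB≈ : Q * (B + + s * D) ≈ + 0 [ m ]
  QB≈ = halve-≈0 (Q * (B + + s * D)) m-odd (begin
    + 2 * (Q * (B + + s * D))
      ≡⟨ lemma₃ Q B D (+ s) ⟩
    Q * (B + (+ 2 * + 0 + + 0) * D) + Q * (B + (+ 2 * + s + + 0) * D)
      ≈⟨ +-≈ (2E≈ 0 0 (s≤s z≤n)) (2E≈ s 0 (ℕₚ.≤-reflexive (cong suc (ℕₚ.+-identityʳ s)))) ⟨
    + 2 * E (0 , 0) + + 2 * E (s , 0)
      ≡⟨ lemma₄ (E (0 , 0)) (E (s , 0)) ⟩
    + 2 * (E (0 , 0) + E (s , 0))
      ≈⟨ *ˡ-≈ (+ 2) antisym ⟩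
    + 0 ∎)
  lemma₅ : ∀ Q Q′ x → Q * Q′ * x ≡ Q′ * (Q * x)
  lemma₅ = solve-∀
  B≈ : B + + s * D ≈ + 0 [ m ]
  B≈ = begin
    B + + s * D                          ≡⟨ ℤₚ.*-identityˡ _ ⟨
    + 1 * (B + + s * D)                  ≈⟨ *ʳ-≈ (B + + s * D) (^-inverse {m} {ς} {ς′} inv (e 0)) ⟨
    Q * ς′ ^ e 0 * (B + + s * D)         ≡⟨ lemma₅ Q (ς′ ^ e 0) (B + + s * D) ⟩
    ς′ ^ e 0 * (Q * (B + + s * D))       ≈⟨ *ˡ-≈ (ς′ ^ e 0) QB≈ ⟩
    ς′ ^ e 0 * + 0                       ≡⟨ ℤₚ.*-zeroʳ (ς′ ^ e 0) ⟩
    + 0                                  ∎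

-- A weighted sum sees an arithmetic progression only through the total weight and the first moment,
-- which will be σ and σ′. The values are doubled to match `orbit-≈`.
sumℤ-affine : ∀ {m a α β} {A : Set a} (W I F : A → ℤ) → (∀ p → + 2 * F p ≈ α + I p * β [ m ]) → ∀ ps →
  + 2 * sumℤ (map (λ p → W p * F p) ps) ≈
  sumℤ (map W ps) * α + sumℤ (map (λ p → I p * W p) ps) * β [ m ]
sumℤ-affine {m} {α = α} {β} W I F 2F≈ [] = ≈-reflexive refl
sumℤ-affine {m} {α = α} {β} W I F 2F≈ (p ∷ ps) = begin
  + 2 * (W p * F p + S)                          ≡⟨ lemma₁ (W p) (F p) S ⟩
  W p * (+ 2 * F p) + + 2 * S                    ≈⟨ +-≈ (*ˡ-≈ (W p) (2F≈ p)) (sumℤ-affine W I F 2F≈ ps) ⟩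
  W p * (α + I p * β) + (ΣW * α + ΣIW * β)       ≡⟨ lemma₂ (W p) (I p) α β ΣW ΣIW ⟩
  (W p + ΣW) * α + (I p * W p + ΣIW) * β         ∎
  where
  open ≈-Reasoning m
  S = sumℤ (map (λ p → W p * F p) ps)
  ΣW = sumℤ (map W ps)
  ΣIW = sumℤ (map (λ p → I p * W p) ps)
  lemma₁ : ∀ w f s → + 2 * (w * f + s) ≡ w * (+ 2 * f) + + 2 * s
  lemma₁ = solve-∀
  lemma₂ : ∀ w i α β u v → w * (α + i * β) + (u * α + v * β) ≡ (w + u) * α + (i * w + v) * β
  lemma₂ = solve-∀

-- Each row is again an arithmetic progression. One application of the automaton multiplies it by σ
-- and, because 2 σ′ = -σ, moves its index by -1/2; doubling clears this half.
orbit-≈ : ∀ {m r} {w : Weights r} {a d} → σ r w ≈ - (+ 2 * σ′ r w) [ m ] → ∀ j i →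
  + 2 * orbit r w a d j i ≈ σ r w ^ j * (+ 2 * a + (+ 2 * i - + j) * d) [ m ]
orbit-≈ {a = a} {d} σ≈ zero    i = ≈-reflexive (lemma a i d)
  where
  lemma : ∀ a i d → + 2 * (a + i * d) ≡ + 1 * (+ 2 * a + (+ 2 * i - + 0) * d)
  lemma = solve-∀
orbit-≈ {m} {r} {w} {a} {d} σ≈ (suc j) i = begin
  + 2 * orbit r w a d (suc j) i
    ≈⟨ sumℤ-affine {m} {α = P * (+ 2 * a + (+ 2 * i - + j) * d)} {+ 2 * P * d}
         (lookup w) (idx r) (λ p → orbit r w a d j (i + idx r p)) affine (allFin _) ⟩
  σ r w * (P * (+ 2 * a + (+ 2 * i - + j) * d)) + σ′ r w * (+ 2 * P * d)
    ≡⟨ lemma₁ (σ r w) (σ′ r w) P a i (+ j) d ⟩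
  σ r w * P * (+ 2 * a + (+ 2 * i - (+ 1 + + j)) * d) + P * d * (σ r w + + 2 * σ′ r w)
    -- The surplus term has the factor σ + 2 σ′, which vanishes modulo m.
    ≈⟨ +ˡ-≈ (σ r w * P * (+ 2 * a + (+ 2 * i - (+ 1 + + j)) * d)) (*ˡ-≈ (P * d) (+ʳ-≈ (+ 2 * σ′ r w) σ≈)) ⟩
  σ r w * P * (+ 2 * a + (+ 2 * i - (+ 1 + + j)) * d) + P * d * (- (+ 2 * σ′ r w) + + 2 * σ′ r w)
    ≡⟨ lemma₂ (σ r w * P * (+ 2 * a + (+ 2 * i - (+ 1 + + j)) * d)) (P * d) (+ 2 * σ′ r w) ⟩
  σ r w * P * (+ 2 * a + (+ 2 * i - + suc j) * d) ∎
  where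
  open ≈-Reasoning m
  P = σ r w ^ j
  lemma₀ : ∀ P a i x j d →
    P * (+ 2 * a + (+ 2 * (i + x) - j) * d) ≡ P * (+ 2 * a + (+ 2 * i - j) * d) + x * (+ 2 * P * d)
  lemma₀ = solve-∀
  affine : ∀ p → + 2 * orbit r w a d j (i + idx r p) ≈
    P * (+ 2 * a + (+ 2 * i - + j) * d) + idx r p * (+ 2 * P * d) [ m ]
  affine p = ≈-trans (orbit-≈ σ≈ j (i + idx r p)) (≈-reflexive (lemma₀ P a i (idx r p) (+ j) d))
  lemma₁ : ∀ s s′ P a i j d →
    s * (P * (+ 2 * a + (+ 2 * i - j) * d)) + s′ * (+ 2 * P * d) ≡
    s * P * (+ 2 * a + (+ 2 * i - (+ 1 + j)) * d) + P * d * (s + + 2 * s′)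
  lemma₁ = solve-∀
  lemma₂ : ∀ x y z → x + y * (- z + z) ≡ x
  lemma₂ = solve-∀

-- The common end of both orientations. The row at depth k has exponent e(k) and length s - k, so
-- ς^e(k) is rewritten as a fixed unit v times a power of ρ given by the length; the unit u of the
-- count is then -D v.
entries-balanced : ∀ {m} .{{_ : NonZero m}} {ς ς′ ρ τ p s B D D⁻¹ v v⁻¹} {e : ℕ → ℕ} (E : ℕ × ℕ → ℤ) →
  Coprime 2 m → ς * ς′ ≈ + 1 [ m ] → ρ * τ ≈ + 1 [ m ] → IsSign m (ρ ^ p) →
  (p ∣ s) × (m ∣ s) ⊎ (p ∣ suc s) × (m ∣ suc s) → D * D⁻¹ ≈ + 1 [ m ] → v * v⁻¹ ≈ + 1 [ m ] → 1 ≤ s →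
  (∀ k → k < s → ς ^ e k ≈ v * ρ ^ (s ℕ.∸ k) [ m ]) →
  (∀ k₁ k₂ → k₁ ℕ.+ k₂ < s → + 2 * E (k₁ , k₂) ≈ ς ^ e k₂ * (B + (+ 2 * + k₁ + + k₂) * D) [ m ]) →
  E (0 , 0) + E (s ℕ.∸ 1 , 0) ≈ + 0 [ m ] →
  ∀ c c′ → length (filter (λ k → m ∣? ℤ.∣ E k - c ∣) (offsets s)) ≡
           length (filter (λ k → m ∣? ℤ.∣ E k - c′ ∣) (offsets s))
entries-balanced {m} {ς} {ς′} {ρ} {τ} {p} {s} {B} {D} {D⁻¹} {v} {v⁻¹} {e}
  E m-odd ςς′≈1 ρτ≈1 ρᵖ size DD⁻¹≈1 vv⁻¹≈1 1≤s powers 2E≈ antisym =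
  count-const {m} {ρ} {τ} {p} {s} {(- D) * v} {(- D⁻¹) * v⁻¹} E m-odd ρτ≈1 unit ρᵖ size form
  where
  open ≈-Reasoning m
  lemma₁ : ∀ D D′ v v′ → - D * v * (- D′ * v′) ≡ D * D′ * (v * v′)
  lemma₁ = solve-∀
  unit : - D * v * (- D⁻¹ * v⁻¹) ≈ + 1 [ m ]
  unit = ≈-trans (≈-reflexive (lemma₁ D D⁻¹ v v⁻¹)) (*-≈ DD⁻¹≈1 vv⁻¹≈1)
  lemma₂ : ∀ D v P z → D * (v * P * z) ≡ D * v * (P * z)
  lemma₂ = solve-∀
  form : ∀ k₁ k₂ → k₁ ℕ.+ k₂ < s →
    + 2 * E (k₁ , k₂) ≈ - D * v * (ρ ^ (s ℕ.∸ k₂) * centred (s ℕ.∸ k₂) k₁) [ m ]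
  form k₁ k₂ k< = begin
    + 2 * E (k₁ , k₂)
      ≈⟨ rows-centred {m} {s} {ς} {ς′} {B} {D} {e} E m-odd ςς′≈1 1≤s 2E≈ antisym k₁ k₂ k< ⟩
    - D * (ς ^ e k₂ * centred (s ℕ.∸ k₂) k₁)
      ≈⟨ *ˡ-≈ (- D) (*ʳ-≈ (centred (s ℕ.∸ k₂) k₁) (powers k₂ (ℕₚ.≤-<-trans (ℕₚ.m≤n+m k₂ k₁) k<))) ⟩
    - D * (v * ρ ^ (s ℕ.∸ k₂) * centred (s ℕ.∸ k₂) k₁)
      ≡⟨ lemma₂ (- D) v (ρ ^ (s ℕ.∸ k₂)) (centred (s ℕ.∸ k₂) k₁) ⟩
    - D * v * (ρ ^ (s ℕ.∸ k₂) * centred (s ℕ.∸ k₂) k₁) ∎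

-- Balance for each of the two orientations.

module _ {m : ℕ} .{{_ : NonZero m}} {r : ℕ} {w : Weights r} {a d d⁻¹ ς′ : ℤ} {p s : ℕ} (m-odd : Coprime 2 m)
         (σ≈ : σ r w ≈ - (+ 2 * σ′ r w) [ m ]) (inv : σ r w * ς′ ≈ + 1 [ m ]) (dd⁻¹≈1 : d * d⁻¹ ≈ + 1 [ m ])
         (σᵖ : IsSign m (σ r w ^ p)) (size : (p ∣ s) × (m ∣ s) ⊎ (p ∣ suc s) × (m ∣ suc s)) (1≤s : 1 ≤ s)
         (x : ℤ) (y : ℕ) where

  private
    ς = σ r w
    B = + 2 * a + (+ 2 * x - + y) * d

  first-row : ∀ {ε} → Antisymmetric01 m r w a d (x , y) ε s →
    entry r w a d (x , y) ε (0 , 0) + entry r w a d (x , y) ε (s ℕ.∸ 1 , 0) ≈ + 0 [ m ]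
  first-row {ε} antisym = mod⇒≈ {m} {entry r w a d (x , y) ε (0 , 0) + entry r w a d (x , y) ε (s ℕ.∸ 1 , 0)}
    (antisym 0 0 1≤s)

  -- Here the exponent y + k grows while the length s - k shrinks, so ρ is the inverse ς′ of σ and v
  -- = σ^(y + s). The first coordinate runs backwards, whence D = -d.
  balanced-up : Antisymmetric01 m r w a d (x , y) (Sign.- , Sign.+) s →
    Balanced m r w a d (x , y) (Sign.- , Sign.+) s
  balanced-up antisym c c′ _ _ = entries-balanced {m} {ς} {ς′} {ς′} {ς} {p} {s} {B} {(- d)} {(- d⁻¹)}
    {ς ^ (y ℕ.+ s)} {ς′ ^ (y ℕ.+ s)} {y ℕ.+_}
    (entry r w a d (x , y) (Sign.- , Sign.+)) m-odd inv inv′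
    -- The power ς′^p is a sign because its product with the sign σ^p is 1.
    (sign-cancelʳ (ς ^ p) (sign-resp (≈-sym (^-inverse inv′ p)) (inj₁ ≈-refl)) σᵖ)
    size (≈-trans (≈-reflexive (lemma₁ d d⁻¹)) dd⁻¹≈1) (^-inverse {m} {ς} {ς′} inv (y ℕ.+ s)) 1≤s powers form
    (first-row antisym) (+ c) (+ c′)
    where
    open ≈-Reasoning m
    inv′ : ς′ * ς ≈ + 1 [ m ]
    inv′ = ≈-trans (≈-reflexive (ℤₚ.*-comm ς′ ς)) inv
    lemma₁ : ∀ x y → - x * - y ≡ x * y
    lemma₁ = solve-∀
    powers : ∀ k → k < s → ς ^ (y ℕ.+ k) ≈ ς ^ (y ℕ.+ s) * ς′ ^ (s ℕ.∸ k) [ m ]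
    powers k k<s = begin
      ς ^ (y ℕ.+ k)                                    ≡⟨ ℤₚ.*-identityʳ _ ⟨
      ς ^ (y ℕ.+ k) * + 1                              ≈⟨ *ˡ-≈ (ς ^ (y ℕ.+ k)) (^-inverse {m} {ς} {ς′} inv n) ⟨
      ς ^ (y ℕ.+ k) * (ς ^ n * ς′ ^ n)                 ≡⟨ ℤₚ.*-assoc (ς ^ (y ℕ.+ k)) (ς ^ n) (ς′ ^ n) ⟨
      ς ^ (y ℕ.+ k) * ς ^ n * ς′ ^ n                   ≡⟨ cong (_* ς′ ^ n) (ℤₚ.^-distribˡ-+-* ς (y ℕ.+ k) n) ⟨
      ς ^ (y ℕ.+ k ℕ.+ n) * ς′ ^ n
        ≡⟨ cong (λ N → ς ^ N * ς′ ^ n)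
             (trans (ℕₚ.+-assoc y k n) (cong (y ℕ.+_) (ℕₚ.m+[n∸m]≡n (ℕₚ.<⇒≤ k<s)))) ⟩
      ς ^ (y ℕ.+ s) * ς′ ^ n                           ∎
      where n = s ℕ.∸ k
    lemma₂ : ∀ a x y d k₁ k₂ → + 2 * a + (+ 2 * (x + - k₁) - (y + k₂)) * d ≡
      + 2 * a + (+ 2 * x - y) * d + (+ 2 * k₁ + k₂) * - d
    lemma₂ = solve-∀
    form : ∀ k₁ k₂ → k₁ ℕ.+ k₂ < s → + 2 * entry r w a d (x , y) (Sign.- , Sign.+) (k₁ , k₂) ≈
      ς ^ (y ℕ.+ k₂) * (B + (+ 2 * + k₁ + + k₂) * - d) [ m ]
    form k₁ k₂ _ = begin
      + 2 * orbitℤ r w a d (x + (Sign.- ℤ.◃ k₁)) (+ y + (Sign.+ ℤ.◃ k₂))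
        ≡⟨ cong₂ (λ i j → + 2 * orbitℤ r w a d (x + i) (+ y + j)) (ℤₚ.-◃n≡-n k₁) (ℤₚ.+◃n≡+n k₂) ⟩
      + 2 * orbit r w a d (y ℕ.+ k₂) (x + - + k₁)
        ≈⟨ orbit-≈ σ≈ (y ℕ.+ k₂) (x + - + k₁) ⟩
      ς ^ (y ℕ.+ k₂) * (+ 2 * a + (+ 2 * (x + - + k₁) - (+ y + + k₂)) * d)
        ≡⟨ cong (ς ^ (y ℕ.+ k₂) *_) (lemma₂ a x (+ y) d (+ k₁) (+ k₂)) ⟩
      ς ^ (y ℕ.+ k₂) * (B + (+ 2 * + k₁ + + k₂) * - d) ∎

  -- The exponent y - k and the length s - k shrink together, so ρ = σ, and v = σ^y ς′^s stands for
  -- σ^(y - s), whose exponent may be negative.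
  balanced-down : InOrbit (x , y) (Sign.+ , Sign.-) s →
    Antisymmetric01 m r w a d (x , y) (Sign.+ , Sign.-) s →
    Balanced m r w a d (x , y) (Sign.+ , Sign.-) s
  balanced-down inOrbit antisym c c′ _ _ = entries-balanced {m} {ς} {ς′} {ς} {ς′} {p} {s} {B} {d} {d⁻¹}
    {ς ^ y * ς′ ^ s} {ς′ ^ y * ς ^ s} {y ℕ.∸_}
    (entry r w a d (x , y) (Sign.+ , Sign.-)) m-odd inv inv σᵖ
    size dd⁻¹≈1 unit 1≤s powers form (first-row antisym) (+ c) (+ c′)
    where
    open ≈-Reasoning m
    lemma₁ : ∀ p q p′ q′ → p * q′ * (p′ * q) ≡ p * p′ * (q * q′)
    lemma₁ = solve-∀
    unit : ς ^ y * ς′ ^ s * (ς′ ^ y * ς ^ s) ≈ + 1 [ m ]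
    unit = ≈-trans (≈-reflexive (lemma₁ (ς ^ y) (ς ^ s) (ς′ ^ y) (ς′ ^ s)))
             (*-≈ (^-inverse {m} {ς} {ς′} inv y) (^-inverse {m} {ς} {ς′} inv s))
    -- The position at offset (0, k) lies in the orbit, so y - k ≥ 0 and the truncated difference in
    -- the exponent is the true one.
    depth≤y : ∀ {k} → k < s → k ≤ y
    depth≤y {k} k<s = ℕₚ.≮⇒≥ λ y<k → ℤₚ.<⇒≱ (below y<k)
      (subst (+ 0 ℤ.≤_) (trans (cong (λ z → + y + z) (ℤₚ.-◃n≡-n k)) (ℤₚ.m-n≡m⊖n y k)) (inOrbit 0 k k<s))
      where
      below : y < k → y ℤ.⊖ k ℤ.< + 0
      below y<k = subst (y ℤ.⊖ k ℤ.<_) (ℤₚ.n⊖n≡0 k) (ℤₚ.⊖-monoˡ-< k y<k)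
    lemma₃ : ∀ j k n s′ → j * (k * n * s′) ≡ j * k * s′ * n
    lemma₃ = solve-∀
    powers : ∀ k → k < s → ς ^ (y ℕ.∸ k) ≈ ς ^ y * ς′ ^ s * ς ^ (s ℕ.∸ k) [ m ]
    powers k k<s = begin
      ς ^ j                                  ≡⟨ ℤₚ.*-identityʳ (ς ^ j) ⟨
      ς ^ j * + 1                            ≈⟨ *ˡ-≈ (ς ^ j) (^-inverse {m} {ς} {ς′} inv s) ⟨
      ς ^ j * (ς ^ s * ς′ ^ s)
        ≡⟨ cong (λ N → ς ^ j * (ς ^ N * ς′ ^ s)) (sym (ℕₚ.m+[n∸m]≡n (ℕₚ.<⇒≤ k<s))) ⟩
      ς ^ j * (ς ^ (k ℕ.+ n) * ς′ ^ s)       ≡⟨ cong (λ z → ς ^ j * (z * ς′ ^ s)) (ℤₚ.^-distribˡ-+-* ς k n) ⟩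
      ς ^ j * (ς ^ k * ς ^ n * ς′ ^ s)       ≡⟨ lemma₃ (ς ^ j) (ς ^ k) (ς ^ n) (ς′ ^ s) ⟩
      ς ^ j * ς ^ k * ς′ ^ s * ς ^ n         ≡⟨ cong (λ z → z * ς′ ^ s * ς ^ n) (ℤₚ.^-distribˡ-+-* ς j k) ⟨
      ς ^ (j ℕ.+ k) * ς′ ^ s * ς ^ n
        ≡⟨ cong (λ N → ς ^ N * ς′ ^ s * ς ^ n) (ℕₚ.m∸n+n≡m (depth≤y k<s)) ⟩
      ς ^ y * ς′ ^ s * ς ^ n                 ∎
      where
      j = y ℕ.∸ k
      n = s ℕ.∸ k
    lemma₂ : ∀ a x y d k₁ k₂ → + 2 * a + (+ 2 * (x + k₁) - y) * d ≡
      + 2 * a + (+ 2 * x - (y + k₂)) * d + (+ 2 * k₁ + k₂) * d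
    lemma₂ = solve-∀
    form : ∀ k₁ k₂ → k₁ ℕ.+ k₂ < s → + 2 * entry r w a d (x , y) (Sign.+ , Sign.-) (k₁ , k₂) ≈
      ς ^ (y ℕ.∸ k₂) * (B + (+ 2 * + k₁ + + k₂) * d) [ m ]
    form k₁ k₂ k< = begin
      + 2 * orbitℤ r w a d (x + (Sign.+ ℤ.◃ k₁)) (+ y + (Sign.- ℤ.◃ k₂))
        ≡⟨ cong₂ (λ i j → + 2 * orbitℤ r w a d (x + i) j) (ℤₚ.+◃n≡+n k₁) height ⟩
      + 2 * orbit r w a d j (x + + k₁)
        ≈⟨ orbit-≈ σ≈ j (x + + k₁) ⟩
      ς ^ j * (+ 2 * a + (+ 2 * (x + + k₁) - + j) * d)
        ≡⟨ cong (ς ^ j *_) (lemma₂ a x (+ j) d (+ k₁) (+ k₂)) ⟩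
      ς ^ j * (+ 2 * a + (+ 2 * x - + (j ℕ.+ k₂)) * d + (+ 2 * + k₁ + + k₂) * d)
        ≡⟨ cong (λ N → ς ^ j * (+ 2 * a + (+ 2 * x - + N) * d + (+ 2 * + k₁ + + k₂) * d)) (ℕₚ.m∸n+n≡m k₂≤y) ⟩
      ς ^ j * (B + (+ 2 * + k₁ + + k₂) * d) ∎
      where
      j = y ℕ.∸ k₂
      k₂≤y : k₂ ≤ y
      k₂≤y = depth≤y (ℕₚ.≤-<-trans (ℕₚ.m≤n+m k₂ k₁) k<)
      height : + y + (Sign.- ℤ.◃ k₂) ≡ + j
      height = trans (cong (λ z → + y + z) (ℤₚ.-◃n≡-n k₂)) (trans (ℤₚ.m-n≡m⊖n y k₂) (ℤₚ.⊖-≥ k₂≤y))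

theorem5p6 : (m : ℕ) → 1 ≤ m → ¬ (2 ∣ m) →
    (r : ℕ) (w : Weights r) →
    σ r w ≡ - (+ 2 * σ′ r w) [mod m ] →
    Invertible m (σ r w) →
    (a d : ℤ) → Invertible m d →
    (p : ℕ) → IsPord m (σ r w) p →
    (s : ℕ) → 1 ≤ s → (lcm p m ∣ s ⊎ lcm p m ∣ suc s) →
    (v : ℤ × ℕ) (ε : Orientation) →
    (ε ≡ (Sign.- , Sign.+) ⊎ ε ≡ (Sign.+ , Sign.-)) →
    InOrbit v ε s →
    Antisymmetric01 m r w a d v ε s →
    Balanced m r w a d v ε s
theorem5p6 m 1≤m ¬2∣m r w σ≡ (ς′ , σς′≡1) a d (d⁻¹ , dd⁻¹≡1) p (_ , σᵖ≡±1 , _) s 1≤s lcm∣ (x , y) ε orientation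
  inOrbit antisym = cases orientation inOrbit antisym
  where
  instance
    m≢0 : NonZero m
    m≢0 = ℕ.>-nonZero 1≤m
  m-odd = odd⇒coprime-2 ¬2∣m
  σ≈ = mod⇒≈ {m} {σ r w} {(- (+ 2 * σ′ r w))} σ≡
  inv = mod⇒≈ {m} {σ r w * ς′} {+ 1} σς′≡1
  dd⁻¹≈1 = mod⇒≈ {m} {d * d⁻¹} {+ 1} dd⁻¹≡1
  σᵖ : IsSign m (σ r w ^ p)
  σᵖ = Sum.map (mod⇒≈ {m} {σ r w ^ p} {+ 1}) (mod⇒≈ {m} {σ r w ^ p} {(- + 1)}) σᵖ≡±1
  split : ∀ {n} → lcm p m ∣ n → (p ∣ n) × (m ∣ n)
  split lcm∣n = ∣-trans (m∣lcm[m,n] p m) lcm∣n , ∣-trans (n∣lcm[m,n] p m) lcm∣n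
  size = Sum.map split split lcm∣
  cases : ∀ {ε} → (ε ≡ (Sign.- , Sign.+) ⊎ ε ≡ (Sign.+ , Sign.-)) →
    InOrbit (x , y) ε s → Antisymmetric01 m r w a d (x , y) ε s → Balanced m r w a d (x , y) ε s
  cases (inj₁ refl) _ =
    balanced-up {m} {r} {w} {a} {d} {d⁻¹} {ς′} {p} {s} m-odd σ≈ inv dd⁻¹≈1 σᵖ size 1≤s x y
  cases (inj₂ refl) inOrbit =
    balanced-down {m} {r} {w} {a} {d} {d⁻¹} {ς′} {p} {s} m-odd σ≈ inv dd⁻¹≈1 σᵖ size 1≤s x y inOrbit
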